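{- Let $n$ be a positive integer and let $G$ be a finite connected simple graph with vertex set $V$ such that every map-automorphism group of $G$ is cyclic in one of the following two senses (the same alternative for all maps): (a) $|V|=n$ and each $\Gamma_M(G)$ is cyclic of some order $d\mid n$, generated by a permutation of $V$ all of whose cycles have length $d$, so that its cycle index is $\frac1d\sum_{k\mid d}\phi(k)s_k^{n/k}$; or (b) $|V|=n+1$ and each $\Gamma_M(G)$ is cyclic of some order $d\mid n$, generated by a permutation fixing one vertex and having all other cycles of length $d$, so that its cycle index is $\frac1d\sum_{k\mid d}\phi(k)s_1s_k^{n/k}$. Then the imbedding sum of $G$ decomposes uniquely as a sum of these cyclic cycle indexes: if $Z(G)=\sum_{d\mid n}c_d\,\frac1d\sum_{k\mid d}\phi(k)s_k^{n/k}$ (resp. with $s_1s_k^{n/k}$) then the coefficients $c_d$ are uniquely determined. Moreover, writing $Z(G)=\sum_{d\mid n}f(n,d)\,s_d^{n/d}$ (resp. $\sum_{d\mid n}f(n,d)\,s_1s_d^{n/d}$), the number $i_d$ of unlabeled imbeddings of $G$ whose map-automorphism group is cyclic of order $d$ satisfies \[ i_d=d\sum_{k:\ d\mid k,\ k\mid n}\frac{f(n,k)}{\phi(k)}\,\mu(k/d), \] where $\phi$ is Euler's function and $\mu$ is the Möbius function.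
   Context: For a vertex $v$, $N(v)$ is its neighborhood. A rotation at $v$ is a cyclic permutation of $N(v)$ (a single cycle through all of $N(v)$); a rotation system $\rho=\{\rho_v\}_{v\in V}$ together with $G$ is a map $M=(G,\rho)$. The automorphism group $\Gamma=\Gamma(G)$ acts on maps by $\rho\mapsto\rho'$ with $\rho'_{\gamma(v)}=\gamma\rho_v\gamma^{ -1}$; the stabilizer of $M$ is the map-automorphism group $\Gamma_M(G)$, and $\Gamma$-orbits of maps are unlabeled imbeddings. $F(\gamma)$ is the set of maps fixed by $\gamma$; $s(\gamma)=\prod_k s_k^{j_k}$ with $j_k$ the number of $k$-cycles of $\gamma$ on $V$; the imbedding sum is $Z(G)=\frac1{|\Gamma|}\sum_{\gamma\in\Gamma}|F(\gamma)|s(\gamma)$; the cycle index of a permutation group $H$ on $V$ is $Z(H)=\frac1{|H|}\sum_{h\in H}s(h)$. -}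

module Defs where

open import Data.Bool using (Bool; true; false; _∧_; _∨_; not; if_then_else_)
open import Data.Nat as ℕ using (ℕ; zero; suc; _≤_; _<_)
import Data.Nat.Properties as ℕP
open import Data.Nat.Divisibility using (_∣_; _∣?_)
open import Data.Nat.GCD using (gcd)
open import Data.Nat.Primality using (prime?)
open import Data.Fin using (Fin; toℕ) renaming (_≟_ to _≟ᶠ_)
open import Data.Vec as V using (Vec; lookup; tabulate)
import Data.Vec.Properties as VP
open import Data.List as L using (List; []; _∷_; length; filter; map; foldr)
open import Data.Bool.ListAction using (any; all)
import Data.List.Relation.Unary.Any as Any
open import Data.Integer as ℤ using (ℤ; +_)
open import Data.Rational as ℚ using (ℚ; 0ℚ; 1ℚ)
open import Data.Product using (Σ; ∃; _×_; _,_)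
open import Relation.Nullary using (¬_)
open import Relation.Nullary.Decidable using (⌊_⌋)
open import Relation.Binary.PropositionalEquality using (_≡_; _≢_)

allVecs : {A : Set} → (n : ℕ) → List A → List (Vec A n)
allVecs zero    xs = V.[] ∷ []
allVecs (suc n) xs = L.concatMap (λ x → map (x V.∷_) (allVecs n xs)) xs

count : {A : Set} → (A → Bool) → List A → ℕ
count p xs = length (L.filterᵇ p xs)

_==_ : ℕ → ℕ → Bool
m == n = ⌊ m ℕ.≟ n ⌋

_=ᶠ_ : {N : ℕ} → Fin N → Fin N → Bool
u =ᶠ v = ⌊ u ≟ᶠ v ⌋

oneTo : ℕ → List ℕ
oneTo n = map suc (L.upTo n)

divisorsOf : ℕ → List ℕ
divisorsOf n = L.filterᵇ (λ k → ⌊ k ∣? n ⌋) (oneTo n)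

-- natural division, with k = 0 giving 0 (never used with k = 0)
_div_ : ℕ → ℕ → ℕ
n div zero    = 0
n div (suc k) = n ℕ./ suc k

φ : ℕ → ℕ
φ n = count (λ k → gcd k n == 1) (oneTo n)

μ : ℕ → ℤ
μ n = if any (λ p → ⌊ prime? p ⌋ ∧ ⌊ (p ℕ.* p) ∣? n ⌋) (oneTo n)
      then + 0
      else (ℤ.- (+ 1)) ℤ.^ count (λ p → ⌊ prime? p ⌋ ∧ ⌊ p ∣? n ⌋) (oneTo n)

fromℕ : ℕ → ℚ
fromℕ n = (+ n) ℚ./ 1

fromℤ : ℤ → ℚ
fromℤ z = z ℚ./ 1

-- 1/n, with 1/0 := 0 (only used for n ≥ 1)
inv : ℕ → ℚ
inv zero    = 0ℚ
inv (suc n) = (+ 1) ℚ./ suc n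

sumℚ : List ℚ → ℚ
sumℚ = foldr ℚ._+_ 0ℚ

record Graph (N : ℕ) : Set where
  field
    adj   : Fin N → Fin N → Bool
    sym   : ∀ u v → adj u v ≡ adj v u
    irrefl : ∀ v → adj v v ≡ false
open Graph public

data Walk {N : ℕ} (G : Graph N) : Fin N → Fin N → Set where
  here : ∀ {v} → Walk G v v
  step : ∀ {u w v} → adj G u w ≡ true → Walk G w v → Walk G u v

Connected : {N : ℕ} → Graph N → Set
Connected {N} G = ∀ (u v : Fin N) → Walk G u v

Perm : ℕ → Set
Perm N = Vec (Fin N) N

app : {N : ℕ} → Perm N → Fin N → Fin N
app = lookup

idP : {N : ℕ} → Perm N
idP {N} = V.allFin N

_∘P_ : {N : ℕ} → Perm N → Perm N → Perm N
g ∘P h = tabulate (λ v → app g (app h v))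

pow : {N : ℕ} → Perm N → ℕ → Perm N
pow g zero    = idP
pow g (suc i) = g ∘P pow g i

iter : {N : ℕ} → (Fin N → Fin N) → ℕ → Fin N → Fin N
iter f zero    x = x
iter f (suc i) x = f (iter f i x)

isInjective : {N : ℕ} → (Fin N → Fin N) → Bool
isInjective {N} f =
  all (λ u → all (λ v → not (f u =ᶠ f v) ∨ (u =ᶠ v)) (L.allFin N)) (L.allFin N)

allPerms : (N : ℕ) → List (Perm N)
allPerms N = L.filterᵇ (λ g → isInjective (app g)) (allVecs N (L.allFin N))

_=P_ : {N : ℕ} → Perm N → Perm N → Bool
g =P h = ⌊ VP.≡-dec _≟ᶠ_ g h ⌋

invApp : {N : ℕ} → Perm N → Fin N → Fin N
invApp {N} γ w with L.filterᵇ (λ u → app γ u =ᶠ w) (L.allFin N)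
... | []    = w
... | u ∷ _ = u

isAut : {N : ℕ} → Graph N → Perm N → Bool
isAut {N} G g = all (λ u → all (λ v →
  ⌊ Data.Bool._≟_ (adj G (app g u) (app g v)) (adj G u v) ⌋) (L.allFin N)) (L.allFin N)
  where import Data.Bool

Aut : {N : ℕ} → Graph N → List (Perm N)
Aut {N} G = L.filterᵇ (isAut G) (allPerms N)

-- Maps (rotation systems)
-- ρ v is stored as a permutation of Fin N which is a cyclic permutation
-- of N(v) (a single cycle through all of N(v)) and the identity off N(v).

RotSys : ℕ → Set
RotSys N = Vec (Vec (Fin N) N) N

rot : {N : ℕ} → RotSys N → Fin N → Fin N → Fin N
rot ρ v u = lookup (lookup ρ v) u

isRotationAt : {N : ℕ} → Graph N → (Fin N → Fin N) → Fin N → Bool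
isRotationAt {N} G r v =
  isInjective r
  ∧ all (λ u → if adj G v u then adj G v (r u) else (r u =ᶠ u)) (L.allFin N)
  ∧ all (λ u → all (λ w → not (adj G v u ∧ adj G v w)
          ∨ any (λ k → iter r k u =ᶠ w) (L.upTo N)) (L.allFin N)) (L.allFin N)

isMap : {N : ℕ} → Graph N → RotSys N → Bool
isMap {N} G ρ = all (λ v → isRotationAt G (rot ρ v) v) (L.allFin N)

allMaps : {N : ℕ} → Graph N → List (RotSys N)
allMaps {N} G = L.filterᵇ (isMap G) (allVecs N (allVecs N (L.allFin N)))

_=M_ : {N : ℕ} → RotSys N → RotSys N → Bool
ρ =M σ = ⌊ VP.≡-dec (VP.≡-dec _≟ᶠ_) ρ σ ⌋

act : {N : ℕ} → Perm N → RotSys N → RotSys N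
act γ ρ = tabulate (λ w → tabulate (λ x →
  app γ (rot ρ (invApp γ w) (invApp γ x))))

stab : {N : ℕ} → Graph N → RotSys N → List (Perm N)
stab G ρ = L.filterᵇ (λ γ → act γ ρ =M ρ) (Aut G)

nFix : {N : ℕ} → Graph N → Perm N → ℕ
nFix G γ = count (λ ρ → act γ ρ =M ρ) (allMaps G)

-- Cycle types and cycle-index polynomials
-- A monomial ∏_k s_k^{j_k} is stored as the vector (j_1, ..., j_N).
-- A polynomial in s_1..s_N with rational coefficients is its coefficient
-- function Mono N → ℚ (only finitely many monomials occur).

Mono : ℕ → Set
Mono N = Vec ℕ N

_=m_ : {N : ℕ} → Mono N → Mono N → Bool
m =m m' = ⌊ VP.≡-dec ℕ._≟_ m m' ⌋

Poly : ℕ → Set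
Poly N = Mono N → ℚ

cycleLen : {N : ℕ} → Perm N → Fin N → ℕ
cycleLen {N} g v with L.filterᵇ (λ k → app (pow g k) v =ᶠ v) (oneTo N)
... | []    = 0
... | k ∷ _ = k

cycleType : {N : ℕ} → Perm N → Mono N
cycleType {N} g = tabulate (λ i →
  count (λ v → cycleLen g v == suc (toℕ i)) (L.allFin N) ℕ./ suc (toℕ i))

[_]ₘ : {N : ℕ} → Mono N → ℕ → Poly N
[ m ]ₘ c m' = if m =m m' then fromℕ c else 0ℚ

cycleIndex : {N : ℕ} → List (Perm N) → Poly N
cycleIndex H m = inv (length H) ℚ.* fromℕ (count (λ h → cycleType h =m m) H)

imbSum : {N : ℕ} → Graph N → Poly N
imbSum G m = inv (length (Aut G)) ℚ.*
  sumℚ (map (λ γ → if cycleType γ =m m then fromℕ (nFix G γ) else 0ℚ) (Aut G))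

data Kind : Set where
  semiregular : Kind   -- (a) |V| = n, all cycles of length d
  oneFixed    : Kind   -- (b) |V| = n+1, one fixed vertex, other cycles of length d

verts : Kind → ℕ → ℕ
verts semiregular n = n
verts oneFixed    n = suc n

monoK : (κ : Kind) (n k : ℕ) → Mono (verts κ n)
monoK semiregular n k = tabulate (λ i → if suc (toℕ i) == k then n div k else 0)
monoK oneFixed    n k = tabulate (λ i →
  (if toℕ i == 0 then 1 else 0) ℕ.+ (if suc (toℕ i) == k then n div k else 0))

cycIdx : (κ : Kind) (n d : ℕ) → Poly (verts κ n)
cycIdx κ n d m = inv d ℚ.* sumℚ (map (λ k → [ monoK κ n k ]ₘ (φ k) m) (divisorsOf d))

Decomposes : (κ : Kind) (n : ℕ) → Poly (verts κ n) → (ℕ → ℚ) → Set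
Decomposes κ n P c = ∀ m → P m ≡ sumℚ (map (λ d → c d ℚ.* cycIdx κ n d m) (divisorsOf n))

CycleOfLength : {N : ℕ} → Perm N → Fin N → ℕ → Set
CycleOfLength g v d = app (pow g d) v ≡ v × (∀ k → 0 < k → k < d → app (pow g k) v ≢ v)

GeneratorShape : (κ : Kind) (n d : ℕ) → Perm (verts κ n) → Set
GeneratorShape semiregular n d g = ∀ v → CycleOfLength g v d
GeneratorShape oneFixed    n d g =
  Σ (Fin (suc n)) λ x → app g x ≡ x × (∀ v → v ≢ x → CycleOfLength g v d)

CyclicHyp : (κ : Kind) (n : ℕ) → Graph (verts κ n) → RotSys (verts κ n) → Set
CyclicHyp κ n G ρ =
  Σ ℕ λ d → d ∣ n × Σ (Perm (verts κ n)) λ g →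
    Any.Any (g ≡_) (stab G ρ)
    × GeneratorShape κ n d g
    × (∀ h → Any.Any (h ≡_) (stab G ρ) → Σ ℕ λ i → pow g i ≡ h)

sameOrbit : {N : ℕ} → Graph N → RotSys N → RotSys N → Bool
sameOrbit G ρ σ = any (λ γ → act γ ρ =M σ) (Aut G)

-- count Γ-orbits satisfying an (invariant) property P: a map is counted
-- iff it satisfies P and no earlier map in the enumeration is in its orbit
orbitCount : {N : ℕ} → Graph N → (RotSys N → Bool) → List (RotSys N) → List (RotSys N) → ℕ
orbitCount G P seen []       = 0
orbitCount G P seen (ρ ∷ ρs) =
  (if P ρ ∧ not (any (sameOrbit G ρ) seen) then 1 else 0)
  ℕ.+ orbitCount G P (ρ ∷ seen) ρs

isCyclicOfOrder : {N : ℕ} → Graph N → ℕ → RotSys N → Bool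
isCyclicOfOrder G d ρ =
  (length (stab G ρ) == d)
  ∧ any (λ g → all (λ h → any (λ i → pow g i =P h) (L.upTo (length (stab G ρ))))
                   (stab G ρ)) (stab G ρ)

numImb : {N : ℕ} → Graph N → ℕ → ℕ
numImb G d = orbitCount G (isCyclicOfOrder G d) [] (allMaps G)

fCoeff : (κ : Kind) (n : ℕ) → Graph (verts κ n) → ℕ → ℚ
fCoeff κ n G d = imbSum G (monoK κ n d)

{-# OPTIONS --safe #-}

-- Counting the pairs (γ , ρ) with γ ρ = ρ in two ways gives Z(G) = |Γ|⁻¹ Σ_ρ Σ_{h ∈ Γ_ρ} s(h). If Γ_ρ is
-- cyclic of order d with generator g, then gⁱ has all its nontrivial cycles of length d / gcd(i , d), and
-- exactly φ(k) of the exponents 1 ≤ i ≤ d give the length k ∣ d, so the inner sum is d times the cyclic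
-- cycle index of order d. By orbit-stabilizer i_d |Γ| / d maps have a stabilizer of order d, hence
-- c_d = i_d is a decomposition of Z(G). Conversely, the coefficient of the monomial of index k in any
-- decomposition is φ(k) Σ_{k ∣ e ∣ n} c_e / e, so Möbius inversion recovers every c_d from Z(G). This
-- proves uniqueness, and applied to c_d = i_d it is the formula for i_d.

module Submission where

open import Defs hiding (sym)
open import Data.Bool using (Bool; true; false; _∧_; _∨_; not; if_then_else_)
import Data.Bool as Bool
import Data.Bool.Properties as BoolP
open import Data.Bool.ListAction using (any; all)
open import Data.Empty using (⊥-elim)
open import Data.Fin as Fin using (Fin; toℕ)
import Data.Fin.Properties as FinP
import Data.Integer as ℤ
import Data.Integer.Properties as ℤP
open import Data.List as L using (List; []; _∷_; _++_; length; map; filterᵇ; allFin; upTo)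
import Data.List.Properties as LP
open import Data.List.Membership.Propositional using (_∈_)
open import Data.List.Membership.Propositional.Properties
  using (∈-cartesianProductWith⁺; ∈-length; ∈-map⁺; ∈-map⁻; ∈-upTo⁺; ∈-upTo⁻; ∈-allFin)
open import Data.List.Membership.Propositional.Properties.WithK using (unique∧set⇒bag)
open import Data.List.Relation.Binary.BagAndSetEquality using (∼bag⇒↭)
open import Data.List.Relation.Binary.Permutation.Propositional as ↭ using (_↭_)
open import Data.List.Relation.Binary.Permutation.Propositional.Properties using (↭-length)
open import Data.List.Relation.Unary.All as All using ([]; _∷_)
open import Data.List.Relation.Unary.AllPairs as AllPairs using ([]; _∷_)
import Data.List.Relation.Unary.AllPairs.Properties as AllPairsP
open import Data.List.Relation.Unary.Any using (here; there)
open import Data.List.Relation.Unary.Any.Properties using (¬Any[])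
open import Data.List.Relation.Unary.Unique.Propositional using (Unique)
import Data.List.Relation.Unary.Unique.Propositional.Properties as Unique
open import Data.Nat as ℕ using (ℕ; zero; suc; _≤_; _<_; z≤n; s≤s; NonZero)
import Data.Nat.Properties as ℕP
import Data.Nat.DivMod as DivMod
open import Data.Nat.Divisibility as Div using (_∣_; _∣?_; divides)
import Data.Nat.Coprimality as Coprime
open import Data.Nat.GCD using (gcd)
import Data.Nat.GCD as GCD
import Data.Nat.Primality.Factorisation as Factorisation
open import Data.Nat.Primality as Prime using (Prime; prime?)
open import Data.Product using (Σ; ∃; _×_; _,_; proj₁; proj₂)
open import Data.Rational as ℚ using (ℚ; 0ℚ; 1ℚ; _+_; _*_; -_)
import Data.Rational.Properties as ℚP
import Data.Rational.Solver as Solver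
import Data.Rational.Unnormalised as ℚᵘ
import Data.Rational.Unnormalised.Properties as ℚᵘP
open import Data.Sum using (inj₁; inj₂)
open import Data.Vec as V using (Vec; lookup; tabulate)
import Data.Vec.Properties as VP
open import Function using (_∘_; id; mk⇔)
open import Relation.Nullary using (¬_; Dec; yes; no)
open import Relation.Binary using (tri<; tri≈; tri>)
open import Relation.Nullary.Decidable using (⌊_⌋)
open import Relation.Binary.PropositionalEquality
  using (_≡_; _≢_; refl; sym; trans; cong; cong₂; subst; subst₂; module ≡-Reasoning)

-- Cardinalities are handled as rational sums of 0/1 indicators `⟦_⟧` over duplicate-free lists.
-- Double counting then is `∑-swap`, a bijection is a rearrangement of lists (`bijection⇒↭`), and
-- counting by fibres is `∑-fibrewise`; no quotient has to be built. The delicate count is `numImb`: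
-- `orbitCount` never names an orbit, it only asks whether a map is equivalent to one already
-- scanned. It is tied to a sum over all maps by an induction on the scan that carries the maps
-- already seen. The two alternatives for generators are merged in `CyclicShape`, which keeps the
-- cycle type of every power, the equation g^d = 1 and one vertex on a cycle of length d. That
-- vertex makes the powers g^1, ..., g^d distinct. This is how d becomes the order of the
-- stabilizer, which the hypothesis on the generator does not assert outright.

⌊⌋⁻ : {P : Set} (P? : Dec P) → ⌊ P? ⌋ ≡ true → P
⌊⌋⁻ (yes p) _ = p

⌊⌋⁺ : {P : Set} (P? : Dec P) → P → ⌊ P? ⌋ ≡ true
⌊⌋⁺ (yes _) _ = refl
⌊⌋⁺ (no ¬p) p = ⊥-elim (¬p p)

⌊⌋-no : {P : Set} (P? : Dec P) → ¬ P → ⌊ P? ⌋ ≡ false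
⌊⌋-no (yes p) ¬p = ⊥-elim (¬p p)
⌊⌋-no (no _)  _  = refl

false≢true : false ≢ true
false≢true ()

Bool-ext : {a b : Bool} → (a ≡ true → b ≡ true) → (b ≡ true → a ≡ true) → a ≡ b
Bool-ext {true}  {true}  f g = refl
Bool-ext {true}  {false} f g = sym (f refl)
Bool-ext {false} {true}  f g = g refl
Bool-ext {false} {false} f g = refl

∧⁻ : {a b : Bool} → a ∧ b ≡ true → a ≡ true × b ≡ true
∧⁻ {true} {true} _ = refl , refl

∧⁺ : {a b : Bool} → a ≡ true → b ≡ true → a ∧ b ≡ true
∧⁺ refl refl = refl

-- Boolean quantifiers, filters and duplicate-free lists

all⁻ : {A : Set} {p : A → Bool} {xs : List A} → all p xs ≡ true → ∀ {x} → x ∈ xs → p x ≡ true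
all⁻ e (here refl) = proj₁ (∧⁻ e)
all⁻ e (there x∈)  = all⁻ (proj₂ (∧⁻ e)) x∈

all⁺ : {A : Set} {p : A → Bool} (xs : List A) → (∀ {x} → x ∈ xs → p x ≡ true) → all p xs ≡ true
all⁺ []       h = refl
all⁺ (x ∷ xs) h = ∧⁺ (h (here refl)) (all⁺ xs (h ∘ there))

any⁺ : {A : Set} {p : A → Bool} {xs : List A} {x : A} → x ∈ xs → p x ≡ true → any p xs ≡ true
any⁺ (here refl) e rewrite e = refl
any⁺ {p = p} {y ∷ _} (there x∈) e with p y
... | true  = refl
... | false = any⁺ x∈ e

any⁻ : {A : Set} {p : A → Bool} (xs : List A) → any p xs ≡ true → ∃ λ x → x ∈ xs × p x ≡ true
any⁻ {p = p} (y ∷ xs) e with p y in eq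
... | true  = y , here refl , eq
... | false with any⁻ xs e
...   | x , x∈ , px = x , there x∈ , px

∈-filterᵇ⁺ : {A : Set} {p : A → Bool} {xs : List A} {x : A} → x ∈ xs → p x ≡ true → x ∈ filterᵇ p xs
∈-filterᵇ⁺ {p = p} (here refl) e rewrite e = here refl
∈-filterᵇ⁺ {p = p} {y ∷ _} (there x∈) e with p y
... | true  = there (∈-filterᵇ⁺ x∈ e)
... | false = ∈-filterᵇ⁺ x∈ e

∈-filterᵇ⁻ : {A : Set} {p : A → Bool} {xs : List A} {x : A} → x ∈ filterᵇ p xs → x ∈ xs × p x ≡ true
∈-filterᵇ⁻ {p = p} {y ∷ xs} x∈ with p y in eq
∈-filterᵇ⁻ (here refl) | true = here refl , eq
∈-filterᵇ⁻ {xs = y ∷ xs} (there x∈) | true with ∈-filterᵇ⁻ {xs = xs} x∈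
... | x∈′ , e = there x∈′ , e
∈-filterᵇ⁻ {xs = y ∷ xs} x∈ | false with ∈-filterᵇ⁻ {xs = xs} x∈
... | x∈′ , e = there x∈′ , e

filterᵇ-unique : {A : Set} (p : A → Bool) {xs : List A} → Unique xs → Unique (filterᵇ p xs)
filterᵇ-unique p = Unique.filter⁺ (BoolP.T? ∘ p)

-- Injectivity is asked only on the entries of `xs`: the powers of a permutation, for instance, are
-- distinct only for exponents in a bounded range.
map-unique : {A B : Set} {h : A → B} {xs : List A} →
  (∀ {x y} → x ∈ xs → y ∈ xs → h x ≡ h y → x ≡ y) → Unique xs → Unique (map h xs)
map-unique {xs = []}     inj []        = []
map-unique {h = h} {xs = x ∷ xs} inj (x≢ ∷ u) =
  All.tabulate (λ {z} z∈ hx≡z → let y , y∈ , z≡hy = ∈-map⁻ h z∈ in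
    All.lookup x≢ y∈ (inj (here refl) (there y∈) (trans hx≡z z≡hy)))
  ∷ map-unique (λ a b → inj (there a) (there b)) u

-- Without repetitions, having the same members already means having the same multiplicities. The
-- bijective counts below go through this.
same-elements⇒↭ : {A : Set} {xs ys : List A} → Unique xs → Unique ys →
  (∀ {x} → x ∈ xs → x ∈ ys) → (∀ {x} → x ∈ ys → x ∈ xs) → xs ↭ ys
same-elements⇒↭ ux uy f g = ∼bag⇒↭ (unique∧set⇒bag ux uy (mk⇔ f g))

-- Finite sums of rationals over lists

∑ : {A : Set} → List A → (A → ℚ) → ℚ
∑ xs f = sumℚ (map f xs)

⟦_⟧ : Bool → ℚ
⟦ b ⟧ = if b then 1ℚ else 0ℚ

∑-cong : {A : Set} (xs : List A) {f g : A → ℚ} → (∀ {x} → x ∈ xs → f x ≡ g x) → ∑ xs f ≡ ∑ xs g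
∑-cong []       h = refl
∑-cong (x ∷ xs) h = cong₂ _+_ (h (here refl)) (∑-cong xs (h ∘ there))

∑-0 : {A : Set} (xs : List A) {f : A → ℚ} → (∀ {x} → x ∈ xs → f x ≡ 0ℚ) → ∑ xs f ≡ 0ℚ
∑-0 []       h = refl
∑-0 (x ∷ xs) h = trans (cong₂ _+_ (h (here refl)) (∑-0 xs (h ∘ there))) (ℚP.+-identityˡ 0ℚ)

+-interchange : ∀ a b c d → (a + b) + (c + d) ≡ (a + c) + (b + d)
+-interchange a b c d = begin
  (a + b) + (c + d) ≡⟨ ℚP.+-assoc a b (c + d) ⟩
  a + (b + (c + d)) ≡⟨ cong (a +_) (ℚP.+-assoc b c d) ⟨
  a + ((b + c) + d) ≡⟨ cong (λ t → a + (t + d)) (ℚP.+-comm b c) ⟩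
  a + ((c + b) + d) ≡⟨ cong (a +_) (ℚP.+-assoc c b d) ⟩
  a + (c + (b + d)) ≡⟨ ℚP.+-assoc a c (b + d) ⟨
  (a + c) + (b + d) ∎
  where open ≡-Reasoning

∑-+ : {A : Set} (xs : List A) (f g : A → ℚ) → ∑ xs (λ x → f x + g x) ≡ ∑ xs f + ∑ xs g
∑-+ []       f g = sym (ℚP.+-identityˡ 0ℚ)
∑-+ (x ∷ xs) f g = trans (cong (f x + g x +_) (∑-+ xs f g)) (+-interchange (f x) (g x) _ _)

∑-*ˡ : {A : Set} (xs : List A) (c : ℚ) (f : A → ℚ) → c * ∑ xs f ≡ ∑ xs (λ x → c * f x)
∑-*ˡ []       c f = ℚP.*-zeroʳ c
∑-*ˡ (x ∷ xs) c f = trans (ℚP.*-distribˡ-+ c (f x) _) (cong (c * f x +_) (∑-*ˡ xs c f))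

∑-swap : {A B : Set} (xs : List A) (ys : List B) (f : A → B → ℚ) →
  ∑ xs (λ x → ∑ ys (f x)) ≡ ∑ ys (λ y → ∑ xs (λ x → f x y))
∑-swap []       ys f = sym (∑-0 ys (λ _ → refl))
∑-swap (x ∷ xs) ys f = trans (cong (∑ ys (f x) +_) (∑-swap xs ys f)) (sym (∑-+ ys (f x) _))

⟦⟧*-zero : ∀ {b} x → b ≡ false → ⟦ b ⟧ * x ≡ 0ℚ
⟦⟧*-zero x refl = ℚP.*-zeroˡ x

⟦⟧*-if : ∀ b x → (if b then x else 0ℚ) ≡ ⟦ b ⟧ * x
⟦⟧*-if true  x = sym (ℚP.*-identityˡ x)
⟦⟧*-if false x = sym (ℚP.*-zeroˡ x)

∑-filterᵇ : {A : Set} (p : A → Bool) (xs : List A) (f : A → ℚ) →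
  ∑ (filterᵇ p xs) f ≡ ∑ xs (λ x → ⟦ p x ⟧ * f x)
∑-filterᵇ p []       f = refl
∑-filterᵇ p (x ∷ xs) f with p x
... | true  = cong₂ _+_ (sym (ℚP.*-identityˡ (f x))) (∑-filterᵇ p xs f)
... | false = trans (∑-filterᵇ p xs f)
  (sym (trans (cong (_+ _) (ℚP.*-zeroˡ (f x))) (ℚP.+-identityˡ _)))

∑-↭ : {A : Set} {xs ys : List A} (f : A → ℚ) → xs ↭ ys → ∑ xs f ≡ ∑ ys f
∑-↭ f ↭.refl          = refl
∑-↭ f (↭.prep x p)    = cong (f x +_) (∑-↭ f p)
∑-↭ f (↭.swap {xs} {ys} x y p) = begin
  f x + (f y + ∑ xs f) ≡⟨ ℚP.+-assoc (f x) (f y) _ ⟨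
  f x + f y + ∑ xs f   ≡⟨ cong₂ _+_ (ℚP.+-comm (f x) (f y)) (∑-↭ f p) ⟩
  f y + f x + ∑ ys f   ≡⟨ ℚP.+-assoc (f y) (f x) _ ⟩
  f y + (f x + ∑ ys f) ∎
  where open ≡-Reasoning
∑-↭ f (↭.trans p q)   = trans (∑-↭ f p) (∑-↭ f q)

∑-map : {A B : Set} (h : A → B) (xs : List A) (f : B → ℚ) → ∑ (map h xs) f ≡ ∑ xs (f ∘ h)
∑-map h xs f = cong sumℚ (sym (LP.map-∘ xs))

bijection⇒↭ : {A B : Set} {xs : List A} {ys : List B} (h : A → B) → Unique xs → Unique ys →
  (∀ {x} → x ∈ xs → h x ∈ ys) →
  (∀ {x y} → x ∈ xs → y ∈ xs → h x ≡ h y → x ≡ y) →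
  (∀ {y} → y ∈ ys → ∃ λ x → x ∈ xs × h x ≡ y) → map h xs ↭ ys
bijection⇒↭ {xs = xs} {ys} h ux uy into inj onto =
  same-elements⇒↭ (map-unique inj ux) uy
    (λ z∈ → let x , x∈ , e = ∈-map⁻ h z∈ in subst (_∈ ys) (sym e) (into x∈))
    (λ y∈ → let x , x∈ , e = onto y∈ in subst (_∈ map h xs) e (∈-map⁺ h x∈))

∑-bijection : {A B : Set} {xs : List A} {ys : List B} (h : A → B) → Unique xs → Unique ys →
  (∀ {x} → x ∈ xs → h x ∈ ys) →
  (∀ {x y} → x ∈ xs → y ∈ xs → h x ≡ h y → x ≡ y) →
  (∀ {y} → y ∈ ys → ∃ λ x → x ∈ xs × h x ≡ y) →
  ∀ (f : B → ℚ) → ∑ xs (f ∘ h) ≡ ∑ ys f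
∑-bijection {xs = xs} h ux uy into inj onto f =
  trans (sym (∑-map h xs f)) (∑-↭ f (bijection⇒↭ h ux uy into inj onto))

∑-single : {A : Set} {xs : List A} {a : A} (f : A → ℚ) → Unique xs → a ∈ xs →
  (∀ {x} → x ∈ xs → x ≢ a → f x ≡ 0ℚ) → ∑ xs f ≡ f a
∑-single {xs = x ∷ xs} f (x≢ ∷ u) (here refl) h =
  trans (cong (f x +_) (∑-0 xs (λ y∈ → h (there y∈) (λ y≡x → All.lookup x≢ y∈ (sym y≡x)))))
        (ℚP.+-identityʳ (f x))
∑-single {xs = x ∷ xs} f (x≢ ∷ u) (there a∈) h =
  trans (cong₂ _+_ (h (here refl) (All.lookup x≢ a∈)) (∑-single f u a∈ (h ∘ there)))
        (ℚP.+-identityˡ _)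

-- The embeddings of ℕ and ℤ in ℚ

toℚᵘ-fromℤ : ∀ z → ℚ.toℚᵘ (fromℤ z) ℚᵘ.≃ ℚᵘ.mkℚᵘ z 0
toℚᵘ-fromℤ z = ℚP.toℚᵘ-fromℚᵘ (ℚᵘ.mkℚᵘ z 0)

fromℕ-injective : ∀ {m n} → fromℕ m ≡ fromℕ n → m ≡ n
fromℕ-injective {m} {n} e
  with ℚᵘ.*≡* eq ← ℚP.fromℚᵘ-injective {ℚᵘ.mkℚᵘ (ℤ.+ m) 0} {ℚᵘ.mkℚᵘ (ℤ.+ n) 0} e =
  ℤP.+-injective (trans (sym (ℤP.*-identityʳ _)) (trans eq (ℤP.*-identityʳ _)))

fromℤ-+ : ∀ a b → fromℤ (a ℤ.+ b) ≡ fromℤ a + fromℤ b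
fromℤ-+ a b = ℚP.toℚᵘ-injective (begin
  ℚ.toℚᵘ (fromℤ (a ℤ.+ b))                    ≈⟨ toℚᵘ-fromℤ (a ℤ.+ b) ⟩
  ℚᵘ.mkℚᵘ (a ℤ.+ b) 0                         ≈⟨ ℚᵘ.*≡* (cong (ℤ._* ℤ.+ 1) (cong₂ ℤ._+_ (ℤP.*-identityʳ a) (ℤP.*-identityʳ b))) ⟨
  ℚᵘ.mkℚᵘ a 0 ℚᵘ.+ ℚᵘ.mkℚᵘ b 0                ≈⟨ ℚᵘP.+-cong (toℚᵘ-fromℤ a) (toℚᵘ-fromℤ b) ⟨
  ℚ.toℚᵘ (fromℤ a) ℚᵘ.+ ℚ.toℚᵘ (fromℤ b)      ≈⟨ ℚP.toℚᵘ-homo-+ (fromℤ a) (fromℤ b) ⟨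
  ℚ.toℚᵘ (fromℤ a + fromℤ b)                  ∎)
  where open ℚᵘP.≃-Reasoning

fromℤ-neg : ∀ a → fromℤ (ℤ.- a) ≡ - fromℤ a
fromℤ-neg a = ℚP.toℚᵘ-injective (begin
  ℚ.toℚᵘ (fromℤ (ℤ.- a))  ≈⟨ toℚᵘ-fromℤ (ℤ.- a) ⟩
  ℚᵘ.- ℚᵘ.mkℚᵘ a 0        ≈⟨ ℚᵘP.-‿cong (toℚᵘ-fromℤ a) ⟨
  ℚᵘ.- ℚ.toℚᵘ (fromℤ a)   ≈⟨ ℚP.toℚᵘ-homo‿- (fromℤ a) ⟨
  ℚ.toℚᵘ (- fromℤ a)      ∎)
  where open ℚᵘP.≃-Reasoning

fromℕ-suc : ∀ n → fromℕ (suc n) ≡ 1ℚ + fromℕ n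
fromℕ-suc n = fromℤ-+ (ℤ.+ 1) (ℤ.+ n)

fromℕ-+ : ∀ m n → fromℕ (m ℕ.+ n) ≡ fromℕ m + fromℕ n
fromℕ-+ m n = fromℤ-+ (ℤ.+ m) (ℤ.+ n)

inv-inverseˡ : ∀ {n} → 0 < n → inv n * fromℕ n ≡ 1ℚ
inv-inverseˡ {suc n} _ = ℚP.toℚᵘ-injective (begin
  ℚ.toℚᵘ (inv (suc n) * fromℕ (suc n))             ≈⟨ ℚP.toℚᵘ-homo-* (inv (suc n)) (fromℕ (suc n)) ⟩
  ℚ.toℚᵘ (inv (suc n)) ℚᵘ.* ℚ.toℚᵘ (fromℕ (suc n)) ≈⟨ ℚᵘP.*-cong (ℚP.toℚᵘ-fromℚᵘ (ℚᵘ.mkℚᵘ (ℤ.+ 1) n)) (toℚᵘ-fromℤ (ℤ.+ suc n)) ⟩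
  ℚᵘ.mkℚᵘ (ℤ.+ 1) n ℚᵘ.* ℚᵘ.mkℚᵘ (ℤ.+ suc n) 0         ≈⟨ ℚᵘP.*-inverseˡ (ℚᵘ.mkℚᵘ (ℤ.+ suc n) 0) ⟩
  ℚᵘ.1ℚᵘ                                           ∎)
  where open ℚᵘP.≃-Reasoning

inv-inverseʳ : ∀ {n} → 0 < n → fromℕ n * inv n ≡ 1ℚ
inv-inverseʳ {n} 0<n = trans (ℚP.*-comm (fromℕ n) (inv n)) (inv-inverseˡ 0<n)

fromℕ-length : {A : Set} (xs : List A) → fromℕ (length xs) ≡ ∑ xs (λ _ → 1ℚ)
fromℕ-length []       = refl
fromℕ-length (x ∷ xs) = trans (fromℕ-suc (length xs)) (cong (1ℚ +_) (fromℕ-length xs))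

fromℕ-count : {A : Set} (p : A → Bool) (xs : List A) → fromℕ (count p xs) ≡ ∑ xs (λ x → ⟦ p x ⟧)
fromℕ-count p xs = trans (fromℕ-length (filterᵇ p xs)) (trans (∑-filterᵇ p xs (λ _ → 1ℚ))
  (∑-cong xs (λ {x} _ → ℚP.*-identityʳ ⟦ p x ⟧)))

-- Each term is multiplied by 1, written as the sum over y of `⟦ eq (h x) y ⟧`, in which only y =
-- `h x` survives; then the two sums are exchanged. The Boolean equality is a parameter because
-- fibres are taken over numbers as well as over maps.
∑-fibrewise : {A B : Set} (eq : B → B → Bool) → (∀ y → eq y y ≡ true) → (∀ {x y} → x ≢ y → eq x y ≡ false) →
  (xs : List A) (ys : List B) (h : A → B) → Unique ys → (∀ {x} → x ∈ xs → h x ∈ ys) → (f : B → ℚ) →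
  ∑ xs (f ∘ h) ≡ ∑ ys (λ y → ∑ xs (λ x → ⟦ eq (h x) y ⟧) * f y)
∑-fibrewise eq eq-refl eq-≢ xs ys h uy into f = begin
  ∑ xs (f ∘ h)
    ≡⟨ ∑-cong xs (λ {x} x∈ → sym (trans
         (∑-single _ uy (into x∈) (λ {y} _ y≢ → trans (cong (λ b → f y * ⟦ b ⟧) (eq-≢ (y≢ ∘ sym))) (ℚP.*-zeroʳ (f y))))
         (trans (cong (λ b → f (h x) * ⟦ b ⟧) (eq-refl (h x))) (ℚP.*-identityʳ (f (h x)))))) ⟩
  ∑ xs (λ x → ∑ ys (λ y → f y * ⟦ eq (h x) y ⟧))
    ≡⟨ ∑-swap xs ys _ ⟩
  ∑ ys (λ y → ∑ xs (λ x → f y * ⟦ eq (h x) y ⟧))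
    ≡⟨ ∑-cong ys (λ {y} _ → trans (sym (∑-*ˡ xs (f y) _)) (ℚP.*-comm (f y) _)) ⟩
  ∑ ys (λ y → ∑ xs (λ x → ⟦ eq (h x) y ⟧) * f y) ∎
  where open ≡-Reasoning

-- Divisors, Euler's function and Möbius inversion

∣⇒0< : ∀ {k n} → 0 < n → k ∣ n → 0 < k
∣⇒0< {zero}  0<n k∣n with refl ← Div.0∣⇒≡0 k∣n = 0<n
∣⇒0< {suc k} 0<n k∣n = s≤s z≤n

∣⇒≤′ : ∀ {k n} → 0 < n → k ∣ n → k ≤ n
∣⇒≤′ 0<n = Div.∣⇒≤ ⦃ ℕ.>-nonZero 0<n ⦄

0<-*ˡ : ∀ m {n} → 0 < m ℕ.* n → 0 < m
0<-*ˡ (suc m) _ = s≤s z≤n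

0<-*ʳ : ∀ m {n} → 0 < m ℕ.* n → 0 < n
0<-*ʳ m {n} p = 0<-*ˡ n (subst (0 <_) (ℕP.*-comm m n) p)

0<-* : ∀ {m n} → 0 < m → 0 < n → 0 < m ℕ.* n
0<-* (s≤s _) (s≤s _) = s≤s z≤n

0<-prime : ∀ {p} → Prime p → 0 < p
0<-prime pp = ℕ.>-nonZero⁻¹ _ ⦃ Prime.prime⇒nonZero pp ⦄

prime≢1 : ∀ {p} → Prime p → p ≢ 1
prime≢1 pp refl = Prime.¬prime[1] pp

prime∣prime⇒≡ : ∀ {p q} → Prime p → Prime q → q ∣ p → q ≡ p
prime∣prime⇒≡ pp pq q∣p with Prime.prime⇒irreducible pp q∣p
... | inj₁ q≡1 = ⊥-elim (prime≢1 pq q≡1)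
... | inj₂ q≡p = q≡p

∃-prime-divisor : ∀ {n} → 0 < n → n ≢ 1 → ∃ λ p → Prime p × p ∣ n
∃-prime-divisor {n} 0<n n≢1 with Factorisation.factorise n ⦃ ℕ.>-nonZero 0<n ⦄
... | record { factors = [] ; isFactorisation = eq } = ⊥-elim (n≢1 eq)
... | record { factors = p ∷ ps ; isFactorisation = eq ; factorsPrime = pp ∷ _ } =
  p , pp , subst (p ∣_) (sym eq) (Div.m∣m*n _)

∈-oneTo⁺ : ∀ {k n} → 0 < k → k ≤ n → k ∈ oneTo n
∈-oneTo⁺ (s≤s _) k≤n = ∈-map⁺ suc (∈-upTo⁺ k≤n)

∈-oneTo⁻ : ∀ {k n} → k ∈ oneTo n → 0 < k × k ≤ n
∈-oneTo⁻ k∈ with i , i∈ , refl ← ∈-map⁻ suc k∈ = s≤s z≤n , ∈-upTo⁻ i∈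

∣⇒∈-oneTo : ∀ {k n} → 0 < n → k ∣ n → k ∈ oneTo n
∣⇒∈-oneTo 0<n k∣n = ∈-oneTo⁺ (∣⇒0< 0<n k∣n) (∣⇒≤′ 0<n k∣n)

oneTo-unique : ∀ n → Unique (oneTo n)
oneTo-unique n = Unique.map⁺ ℕP.suc-injective (Unique.upTo⁺ n)

∈-divisorsOf⁺ : ∀ {k n} → 0 < n → k ∣ n → k ∈ divisorsOf n
∈-divisorsOf⁺ {k} {n} 0<n k∣n = ∈-filterᵇ⁺ (∣⇒∈-oneTo 0<n k∣n) (⌊⌋⁺ (k ∣? n) k∣n)

∈-divisorsOf⁻ : ∀ {k n} → k ∈ divisorsOf n → k ∣ n
∈-divisorsOf⁻ {k} {n} k∈ = ⌊⌋⁻ (k ∣? n) (proj₂ (∈-filterᵇ⁻ {xs = oneTo n} k∈))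

divisorsOf-unique : ∀ n → Unique (divisorsOf n)
divisorsOf-unique n = filterᵇ-unique _ (oneTo-unique n)

==⁻ : ∀ {m n} → (m == n) ≡ true → m ≡ n
==⁻ {m} {n} = ⌊⌋⁻ (m ℕ.≟ n)

==⁺ : ∀ {m n} → m ≡ n → (m == n) ≡ true
==⁺ {m} {n} = ⌊⌋⁺ (m ℕ.≟ n)

==-≢ : ∀ {m n} → m ≢ n → (m == n) ≡ false
==-≢ {m} {n} = ⌊⌋-no (m ℕ.≟ n)

*-div : ∀ m {n} → 0 < n → (m ℕ.* n) div n ≡ m
*-div m {suc n} _ = DivMod.m*n/n≡m m (suc n)

-- The two tests inside `μ`, named so that each can be compared at `p * e` and at `e`.
squareDividesᵇ primeDividesᵇ : ℕ → ℕ → Bool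
squareDividesᵇ n p = ⌊ prime? p ⌋ ∧ ⌊ (p ℕ.* p) ∣? n ⌋
primeDividesᵇ  n p = ⌊ prime? p ⌋ ∧ ⌊ p ∣? n ⌋

μ-square : ∀ {p d} → Prime p → 0 < d → p ℕ.* p ∣ d → μ d ≡ ℤ.0ℤ
μ-square {p} {d} pp 0<d p²∣d
  rewrite any⁺ {p = squareDividesᵇ d} {x = p} (∣⇒∈-oneTo 0<d (Div.∣-trans (Div.m∣m*n p) p²∣d))
               (∧⁺ (⌊⌋⁺ (prime? p) pp) (⌊⌋⁺ (p ℕ.* p ∣? d) p²∣d)) = refl

module _ {p e : ℕ} (pp : Prime p) (0<e : 0 < e) (p∤e : ¬ p ∣ e) where

  private
    instance
      p≢0 = Prime.prime⇒nonZero pp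

    0<pe : 0 < p ℕ.* e
    0<pe = 0<-* (0<-prime pp) 0<e

    -- Euclid's lemma is applied twice, once for each factor q. Whenever q falls on p, it equals p
    -- and forces p ∣ e, which is excluded; so both factors fall on e.
    square∣⇒ : ∀ {q} → Prime q → q ℕ.* q ∣ p ℕ.* e → q ℕ.* q ∣ e
    square∣⇒ {q} pq q²∣pe with Prime.euclidsLemma p e pq (Div.∣-trans (Div.m∣m*n q) q²∣pe)
    ... | inj₁ q∣p with refl ← prime∣prime⇒≡ pp pq q∣p = ⊥-elim (p∤e (Div.*-cancelˡ-∣ p q²∣pe))
    ... | inj₂ (divides f refl)
          with Prime.euclidsLemma p f pq (Div.*-cancelʳ-∣ q ⦃ Prime.prime⇒nonZero pq ⦄
                 (subst (q ℕ.* q ∣_) (sym (ℕP.*-assoc p f q)) q²∣pe))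
    ...   | inj₁ q∣p with refl ← prime∣prime⇒≡ pp pq q∣p = ⊥-elim (p∤e (Div.n∣m*n f))
    ...   | inj₂ q∣f = Div.*-monoˡ-∣ q q∣f

    squarefree≡ : any (squareDividesᵇ (p ℕ.* e)) (oneTo (p ℕ.* e)) ≡ any (squareDividesᵇ e) (oneTo e)
    squarefree≡ = Bool-ext to from
      where
      to : any (squareDividesᵇ (p ℕ.* e)) (oneTo (p ℕ.* e)) ≡ true → any (squareDividesᵇ e) (oneTo e) ≡ true
      to h = let q , _ , hq = any⁻ {p = squareDividesᵇ (p ℕ.* e)} (oneTo (p ℕ.* e)) h
                 pq = ⌊⌋⁻ (prime? q) (proj₁ (∧⁻ hq))
                 q²∣e = square∣⇒ pq (⌊⌋⁻ (q ℕ.* q ∣? p ℕ.* e) (proj₂ (∧⁻ {⌊ prime? q ⌋} hq)))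
             in any⁺ {p = squareDividesᵇ e} {x = q} (∣⇒∈-oneTo 0<e (Div.∣-trans (Div.m∣m*n q) q²∣e))
                     (∧⁺ (⌊⌋⁺ (prime? q) pq) (⌊⌋⁺ (q ℕ.* q ∣? e) q²∣e))
      from : any (squareDividesᵇ e) (oneTo e) ≡ true → any (squareDividesᵇ (p ℕ.* e)) (oneTo (p ℕ.* e)) ≡ true
      from h = let q , _ , hq = any⁻ {p = squareDividesᵇ e} (oneTo e) h
                   pq = ⌊⌋⁻ (prime? q) (proj₁ (∧⁻ hq))
                   q²∣pe = Div.∣-trans (⌊⌋⁻ (q ℕ.* q ∣? e) (proj₂ (∧⁻ {⌊ prime? q ⌋} hq))) (Div.n∣m*n p)
               in any⁺ {p = squareDividesᵇ (p ℕ.* e)} {x = q} (∣⇒∈-oneTo 0<pe (Div.∣-trans (Div.m∣m*n q) q²∣pe))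
                       (∧⁺ (⌊⌋⁺ (prime? q) pq) (⌊⌋⁺ (q ℕ.* q ∣? p ℕ.* e) q²∣pe))

    primeDivisors : ℕ → List ℕ
    primeDivisors n = filterᵇ (primeDividesᵇ n) (oneTo n)

    ∈-primeDivisors⁺ : ∀ {q n} → 0 < n → Prime q → q ∣ n → q ∈ primeDivisors n
    ∈-primeDivisors⁺ {q} {n} 0<n pq q∣n =
      ∈-filterᵇ⁺ (∣⇒∈-oneTo 0<n q∣n) (∧⁺ (⌊⌋⁺ (prime? q) pq) (⌊⌋⁺ (q ∣? n) q∣n))

    ∈-primeDivisors⁻ : ∀ {q n} → q ∈ primeDivisors n → Prime q × q ∣ n
    ∈-primeDivisors⁻ {q} {n} q∈ with ∧⁻ (proj₂ (∈-filterᵇ⁻ {xs = oneTo n} q∈))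
    ... | a , b = ⌊⌋⁻ (prime? q) a , ⌊⌋⁻ (q ∣? n) b

    primeDivisors↭ : primeDivisors (p ℕ.* e) ↭ p ∷ primeDivisors e
    primeDivisors↭ = same-elements⇒↭
      (filterᵇ-unique _ (oneTo-unique (p ℕ.* e)))
      (All.tabulate (λ q∈ p≡q → p∤e (subst (_∣ e) (sym p≡q) (proj₂ (∈-primeDivisors⁻ q∈))))
        ∷ filterᵇ-unique _ (oneTo-unique e))
      to from
      where
      to : ∀ {q} → q ∈ primeDivisors (p ℕ.* e) → q ∈ p ∷ primeDivisors e
      to q∈ with ∈-primeDivisors⁻ q∈
      ... | pq , q∣pe with Prime.euclidsLemma p e pq q∣pe
      ...   | inj₁ q∣p = here (prime∣prime⇒≡ pp pq q∣p)
      ...   | inj₂ q∣e = there (∈-primeDivisors⁺ 0<e pq q∣e)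
      from : ∀ {q} → q ∈ p ∷ primeDivisors e → q ∈ primeDivisors (p ℕ.* e)
      from (here refl) = ∈-primeDivisors⁺ 0<pe pp (Div.m∣m*n e)
      from (there q∈) with ∈-primeDivisors⁻ q∈
      ... | pq , q∣e = ∈-primeDivisors⁺ 0<pe pq (Div.∣n⇒∣m*n p q∣e)

    if-neg : ∀ b z → (if b then ℤ.0ℤ else ℤ.- z) ≡ ℤ.- (if b then ℤ.0ℤ else z)
    if-neg true  z = refl
    if-neg false z = refl

  -- Since p does not divide e, the factor p adds no square of a prime and exactly one prime
  -- divisor: the test for squares is unchanged and the exponent of -1 grows by one.
  μ-prime-* : μ (p ℕ.* e) ≡ ℤ.- μ e
  μ-prime-* = trans
    (cong₂ (λ b w → if b then ℤ.0ℤ else (ℤ.- (ℤ.+ 1)) ℤ.^ w) squarefree≡ (↭-length primeDivisors↭))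
    (trans (cong (λ z → if any (squareDividesᵇ e) (oneTo e) then ℤ.0ℤ else z) (ℤP.-1*i≡-i _))
           (if-neg (any (squareDividesᵇ e) (oneTo e)) _))

-- For a prime p ∣ n, the divisors d and p d with p ∤ d contribute opposite values, and μ vanishes on
-- the divisors divisible by p².
∑-μ : ∀ {n} → 0 < n → ∑ (divisorsOf n) (fromℤ ∘ μ) ≡ ⟦ n == 1 ⟧
∑-μ {n} 0<n with n ℕ.≟ 1
... | yes refl = refl
... | no n≢1 with p , pp , p∣n ← ∃-prime-divisor 0<n n≢1 = begin
  ∑ D M                                           ≡⟨ ∑-cong D split ⟩
  ∑ D (λ d → ⟦ α d ⟧ * M d + ⟦ β d ⟧ * M d)       ≡⟨ ∑-+ D _ _ ⟩
  ∑ D (λ d → ⟦ α d ⟧ * M d) + ∑ D (λ d → ⟦ β d ⟧ * M d)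
                                                  ≡⟨ cong₂ _+_ (∑-filterᵇ α D M) (∑-filterᵇ β D M) ⟨
  ∑ A M + ∑ B M                                   ≡⟨ cong (∑ A M +_) (∑-bijection (p ℕ.*_) uA uB into (λ _ _ → ℕP.*-cancelˡ-≡ _ _ p) onto M) ⟨
  ∑ A M + ∑ A (M ∘ (p ℕ.*_))                      ≡⟨ ∑-+ A _ _ ⟨
  ∑ A (λ d → M d + M (p ℕ.* d))                   ≡⟨ ∑-0 A cancel ⟩
  0ℚ                                              ∎
  where
  open ≡-Reasoning
  instance
    p≢0 : NonZero p
    p≢0 = Prime.prime⇒nonZero pp
  D = divisorsOf n
  M : ℕ → ℚ
  M = fromℤ ∘ μ
  α β : ℕ → Bool
  α d = not ⌊ p ∣? d ⌋
  β d = ⌊ p ∣? d ⌋ ∧ not ⌊ p ℕ.* p ∣? d ⌋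
  A = filterᵇ α D
  B = filterᵇ β D
  uA = filterᵇ-unique α (divisorsOf-unique n)
  uB = filterᵇ-unique β (divisorsOf-unique n)

  split : ∀ {d} → d ∈ D → M d ≡ ⟦ α d ⟧ * M d + ⟦ β d ⟧ * M d
  split {d} d∈ with p ∣? d
  ... | no _  = sym (trans (cong₂ _+_ (ℚP.*-identityˡ (M d)) (ℚP.*-zeroˡ (M d))) (ℚP.+-identityʳ (M d)))
  ... | yes _ with p ℕ.* p ∣? d
  ...   | no _     = sym (trans (cong₂ _+_ (ℚP.*-zeroˡ (M d)) (ℚP.*-identityˡ (M d))) (ℚP.+-identityˡ (M d)))
  ...   | yes p²∣d =
    trans (cong fromℤ (μ-square pp (∣⇒0< 0<n (∈-divisorsOf⁻ d∈)) p²∣d))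
          (sym (trans (cong₂ _+_ (ℚP.*-zeroˡ (M d)) (ℚP.*-zeroˡ (M d))) (ℚP.+-identityˡ 0ℚ)))

  ∈A⁻ : ∀ {d} → d ∈ A → d ∣ n × ¬ p ∣ d
  ∈A⁻ {d} d∈ with ∈-filterᵇ⁻ {xs = D} d∈
  ... | d∈D , αd with p ∣? d
  ...   | no p∤d = ∈-divisorsOf⁻ d∈D , p∤d

  ∈A⁺ : ∀ {d} → d ∣ n → ¬ p ∣ d → d ∈ A
  ∈A⁺ {d} d∣n p∤d = ∈-filterᵇ⁺ (∈-divisorsOf⁺ 0<n d∣n) (cong not (⌊⌋-no (p ∣? d) p∤d))

  into : ∀ {d} → d ∈ A → p ℕ.* d ∈ B
  into {d} d∈ with ∈A⁻ d∈
  -- With n = q d, the prime p divides q because it does not divide d; hence p d still divides n.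
  ... | divides q refl , p∤d with Prime.euclidsLemma q d pp p∣n
  ...   | inj₂ p∣d = ⊥-elim (p∤d p∣d)
  ...   | inj₁ p∣q = ∈-filterᵇ⁺ (∈-divisorsOf⁺ 0<n (Div.*-monoˡ-∣ d p∣q))
          (∧⁺ (⌊⌋⁺ (p ∣? p ℕ.* d) (Div.m∣m*n d))
              (cong not (⌊⌋-no (p ℕ.* p ∣? p ℕ.* d) (p∤d ∘ Div.*-cancelˡ-∣ p))))

  onto : ∀ {d} → d ∈ B → ∃ λ e → e ∈ A × p ℕ.* e ≡ d
  onto {d} d∈ with ∈-filterᵇ⁻ {xs = D} d∈
  ... | d∈D , βd with p ∣? d
  ...   | yes (divides e refl) with p ℕ.* p ∣? e ℕ.* p
  ...     | no p²∤d = e , ∈A⁺ (Div.∣-trans (Div.m∣m*n p) (∈-divisorsOf⁻ d∈D)) (p²∤d ∘ Div.*-monoˡ-∣ p)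
                        , ℕP.*-comm p e

  cancel : ∀ {d} → d ∈ A → M d + M (p ℕ.* d) ≡ 0ℚ
  cancel {d} d∈ with ∈A⁻ d∈
  ... | d∣n , p∤d = trans (cong (M d +_) (trans (cong fromℤ (μ-prime-* pp (∣⇒0< 0<n d∣n) p∤d)) (fromℤ-neg (μ d))))
                          (ℚP.+-inverseʳ (M d))

*-swapˡ : ∀ a b c → a * (b * c) ≡ b * (a * c)
*-swapˡ a b c = trans (sym (ℚP.*-assoc a b c)) (trans (cong (_* c) (ℚP.*-comm a b)) (ℚP.*-assoc b a c))

-- The index set of the Möbius sum, written with the same filter as in the formula to be proved, so
-- that the two agree by definition.
multiplesIn : ℕ → ℕ → List ℕ
multiplesIn d n = filterᵇ (λ k → ⌊ d ∣? k ⌋) (divisorsOf n)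

∈-multiplesIn⁺ : ∀ {d k n} → 0 < n → d ∣ k → k ∣ n → k ∈ multiplesIn d n
∈-multiplesIn⁺ {d} {k} 0<n d∣k k∣n = ∈-filterᵇ⁺ (∈-divisorsOf⁺ 0<n k∣n) (⌊⌋⁺ (d ∣? k) d∣k)

∈-multiplesIn⁻ : ∀ {d k n} → k ∈ multiplesIn d n → d ∣ k × k ∣ n
∈-multiplesIn⁻ {d} {k} {n} k∈ with ∈-filterᵇ⁻ {xs = divisorsOf n} k∈
... | k∈D , e = ⌊⌋⁻ (d ∣? k) e , ∈-divisorsOf⁻ k∈D

-- If e = q d, the contributing k are the j d with j ∣ q, and the sum becomes that of μ over the
-- divisors of q. If d does not divide e, no k contributes.
∑-μ-interval : ∀ {n d e} → 0 < n → d ∣ n → e ∣ n →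
  ∑ (multiplesIn d n) (λ k → ⟦ ⌊ k ∣? e ⌋ ⟧ * fromℤ (μ (k div d))) ≡ ⟦ e == d ⟧
∑-μ-interval {n} {d} {e} 0<n d∣n e∣n with d ∣? e
... | no d∤e = trans
  (∑-0 (multiplesIn d n) (λ {k} k∈ → ⟦⟧*-zero _ (⌊⌋-no (k ∣? e)
    (λ k∣e → d∤e (Div.∣-trans (proj₁ (∈-multiplesIn⁻ {n = n} k∈)) k∣e)))))
  (cong ⟦_⟧ (sym (==-≢ (λ e≡d → d∤e (subst (d ∣_) (sym e≡d) Div.∣-refl)))))
... | yes (divides q refl) = begin
  ∑ (multiplesIn d n) (λ k → ⟦ ⌊ k ∣? q ℕ.* d ⌋ ⟧ * fromℤ (μ (k div d)))
    ≡⟨ ∑-filterᵇ (λ k → ⌊ k ∣? q ℕ.* d ⌋) (multiplesIn d n) _ ⟨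
  ∑ (filterᵇ (λ k → ⌊ k ∣? q ℕ.* d ⌋) (multiplesIn d n)) (λ k → fromℤ (μ (k div d)))
    ≡⟨ ∑-bijection (ℕ._* d) (divisorsOf-unique q) (filterᵇ-unique _ (filterᵇ-unique _ (divisorsOf-unique n)))
         into (λ _ _ → ℕP.*-cancelʳ-≡ _ _ d) onto (λ k → fromℤ (μ (k div d))) ⟨
  ∑ (divisorsOf q) (λ j → fromℤ (μ ((j ℕ.* d) div d)))
    ≡⟨ ∑-cong (divisorsOf q) (λ {j} _ → cong (fromℤ ∘ μ) (*-div j 0<d)) ⟩
  ∑ (divisorsOf q) (fromℤ ∘ μ)
    ≡⟨ ∑-μ (0<-*ˡ q 0<qd) ⟩
  ⟦ q == 1 ⟧
    ≡⟨ cong ⟦_⟧ (Bool-ext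
         (λ h → ==⁺ (trans (cong (ℕ._* d) (==⁻ {q} h)) (ℕP.*-identityˡ d)))
         (λ h → ==⁺ (ℕP.*-cancelʳ-≡ q 1 d (trans (==⁻ {q ℕ.* d} h) (sym (ℕP.*-identityˡ d)))))) ⟩
  ⟦ (q ℕ.* d) == d ⟧ ∎
  where
  open ≡-Reasoning
  0<d : 0 < d
  0<d = ∣⇒0< 0<n d∣n
  0<qd : 0 < q ℕ.* d
  0<qd = ∣⇒0< 0<n e∣n
  instance
    d≢0 : NonZero d
    d≢0 = ℕ.>-nonZero 0<d
  into : ∀ {j} → j ∈ divisorsOf q → j ℕ.* d ∈ filterᵇ (λ k → ⌊ k ∣? q ℕ.* d ⌋) (multiplesIn d n)
  into {j} j∈ = let jd∣qd = Div.*-monoˡ-∣ d (∈-divisorsOf⁻ {n = q} j∈) in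
    ∈-filterᵇ⁺ (∈-multiplesIn⁺ 0<n (Div.n∣m*n j) (Div.∣-trans jd∣qd e∣n)) (⌊⌋⁺ (j ℕ.* d ∣? q ℕ.* d) jd∣qd)
  onto : ∀ {k} → k ∈ filterᵇ (λ k → ⌊ k ∣? q ℕ.* d ⌋) (multiplesIn d n) →
         ∃ λ j → j ∈ divisorsOf q × j ℕ.* d ≡ k
  onto {k} k∈ with ∈-filterᵇ⁻ {xs = multiplesIn d n} k∈
  ... | k∈F , k∣e with ∈-multiplesIn⁻ {n = n} k∈F
  ...   | divides j refl , _ = j , ∈-divisorsOf⁺ {n = q} (0<-*ˡ q 0<qd)
            (Div.*-cancelʳ-∣ d (⌊⌋⁻ (j ℕ.* d ∣? q ℕ.* d) k∣e)) , refl

-- Exchanging the two sums leaves, for each e, the sum of μ(k/d) over d ∣ k ∣ e, which singles out e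
-- = d. This is the inversion over multiples, not the one over divisors.
möbius-inversion : ∀ {n d} (a : ℕ → ℚ) → 0 < n → d ∣ n →
  ∑ (multiplesIn d n) (λ k → ∑ (divisorsOf n) (λ e → ⟦ ⌊ k ∣? e ⌋ ⟧ * a e) * fromℤ (μ (k div d))) ≡ a d
möbius-inversion {n} {d} a 0<n d∣n = begin
  ∑ F (λ k → ∑ D (λ e → ⟦ ⌊ k ∣? e ⌋ ⟧ * a e) * M k)
    ≡⟨ ∑-cong F (λ {k} _ → trans (ℚP.*-comm _ (M k)) (∑-*ˡ D (M k) _)) ⟩
  ∑ F (λ k → ∑ D (λ e → M k * (⟦ ⌊ k ∣? e ⌋ ⟧ * a e)))
    ≡⟨ ∑-swap F D _ ⟩
  ∑ D (λ e → ∑ F (λ k → M k * (⟦ ⌊ k ∣? e ⌋ ⟧ * a e)))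
    ≡⟨ ∑-cong D (λ {e} e∈ → trans (∑-cong F (λ {k} _ → rearrange (M k) ⟦ ⌊ k ∣? e ⌋ ⟧ (a e)))
         (trans (sym (∑-*ˡ F (a e) _)) (cong (a e *_) (∑-μ-interval 0<n d∣n (∈-divisorsOf⁻ e∈))))) ⟩
  ∑ D (λ e → a e * ⟦ e == d ⟧)
    ≡⟨ ∑-single _ (divisorsOf-unique n) (∈-divisorsOf⁺ 0<n d∣n)
         (λ {e} _ e≢d → trans (cong (λ b → a e * ⟦ b ⟧) (==-≢ e≢d)) (ℚP.*-zeroʳ (a e))) ⟩
  a d * ⟦ d == d ⟧
    ≡⟨ cong (λ b → a d * ⟦ b ⟧) (==⁺ {d} refl) ⟩
  a d * 1ℚ
    ≡⟨ ℚP.*-identityʳ (a d) ⟩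
  a d ∎
  where
  open ≡-Reasoning
  F = multiplesIn d n
  D = divisorsOf n
  M : ℕ → ℚ
  M k = fromℤ (μ (k div d))
  rearrange : ∀ x y z → x * (y * z) ≡ z * (y * x)
  rearrange x y z = trans (*-swapˡ x y z) (trans (cong (y *_) (ℚP.*-comm x z)) (*-swapˡ y z x))

-- For d > 0, the order of i in the additive group ℤ/d. It is 1 at i = d, the value that stands for
-- the identity in `oneTo d`.
order : ℕ → ℕ → ℕ
order d i = d div gcd i d

-- Exponents modulo d sorted by their order

module _ {d : ℕ} (0<d : 0 < d) where

  0<-gcd : ∀ i → 0 < gcd i d
  0<-gcd i = ∣⇒0< 0<d (GCD.gcd[m,n]∣n i d)

  order-* : ∀ i → order d i ℕ.* gcd i d ≡ d
  order-* i with GCD.gcd[m,n]∣n i d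
  ... | divides k eq = trans (cong (λ z → (z div gcd i d) ℕ.* gcd i d) eq)
                             (trans (cong (ℕ._* gcd i d) (*-div k (0<-gcd i))) (sym eq))

  order∣ : ∀ i → order d i ∣ d
  order∣ i = divides (gcd i d) (trans (sym (order-* i)) (ℕP.*-comm (order d i) (gcd i d)))

  -- Put q = d/k. The exponents of order k are those with gcd(i, d) = q. They are the multiples j q
  -- with j ≤ k coprime to k, since gcd(j q, d) = q gcd(j, k).
  φ-count : ∀ {k} → k ∣ d → ∑ (oneTo d) (λ i → ⟦ order d i == k ⟧) ≡ fromℕ (φ k)
  φ-count {k} (divides q d≡qk) = begin
    ∑ (oneTo d) (λ i → ⟦ order d i == k ⟧)        ≡⟨ fromℕ-count (λ i → order d i == k) (oneTo d) ⟨
    fromℕ (count (λ i → order d i == k) (oneTo d)) ≡⟨ cong fromℕ (↭-length image) ⟨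
    fromℕ (length (map (ℕ._* q) T))                ≡⟨ cong fromℕ (LP.length-map (ℕ._* q) T) ⟩
    fromℕ (φ k)                                    ∎
    where
    open ≡-Reasoning
    T = filterᵇ (λ j → gcd j k == 1) (oneTo k)
    0<qk : 0 < q ℕ.* k
    0<qk = subst (0 <_) d≡qk 0<d
    instance
      q≢0 : NonZero q
      q≢0 = ℕ.>-nonZero (0<-*ˡ q 0<qk)
      k≢0 : NonZero k
      k≢0 = ℕ.>-nonZero (0<-*ʳ q 0<qk)
    d≡kq : d ≡ k ℕ.* q
    d≡kq = trans d≡qk (ℕP.*-comm q k)
    gcd-scale : ∀ j → gcd (j ℕ.* q) d ≡ q ℕ.* gcd j k
    gcd-scale j = trans (cong₂ gcd (ℕP.*-comm j q) d≡qk) (sym (GCD.c*gcd[m,n]≡gcd[cm,cn] q j k))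
    into : ∀ {j} → j ∈ T → j ℕ.* q ∈ filterᵇ (λ i → order d i == k) (oneTo d)
    into {j} j∈ with ∈-filterᵇ⁻ {xs = oneTo k} j∈
    ... | j∈1k , gcd≡1 with ∈-oneTo⁻ j∈1k
    ...   | 0<j , j≤k = ∈-filterᵇ⁺
            (∈-oneTo⁺ (0<-* 0<j (0<-*ˡ q 0<qk)) (subst (j ℕ.* q ≤_) (sym d≡kq) (ℕP.*-monoˡ-≤ q j≤k)))
            (==⁺ (trans (cong₂ _div_ d≡kq
                    (trans (gcd-scale j) (trans (cong (q ℕ.*_) (==⁻ {gcd j k} gcd≡1)) (ℕP.*-identityʳ q))))
                    (*-div k (0<-*ˡ q 0<qk))))
    onto : ∀ {i} → i ∈ filterᵇ (λ i → order d i == k) (oneTo d) → ∃ λ j → j ∈ T × j ℕ.* q ≡ i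
    onto {i} i∈ with ∈-filterᵇ⁻ {xs = oneTo d} i∈
    ... | i∈1d , ord≡k = helper (subst (_∣ i) gcd≡q (GCD.gcd[m,n]∣m i d)) (∈-oneTo⁻ i∈1d)
      where
      gcd≡q : gcd i d ≡ q
      gcd≡q = ℕP.*-cancelˡ-≡ (gcd i d) q k
        (trans (cong (ℕ._* gcd i d) (sym (==⁻ {order d i} ord≡k))) (trans (order-* i) d≡kq))
      helper : q ∣ i → 0 < i × i ≤ d → ∃ λ j → j ∈ T × j ℕ.* q ≡ i
      helper (divides j refl) (0<i , i≤d) = j ,
        ∈-filterᵇ⁺ (∈-oneTo⁺ (0<-*ˡ j 0<i) (ℕP.*-cancelʳ-≤ j k q (subst (j ℕ.* q ≤_) d≡kq i≤d)))
          (==⁺ (ℕP.*-cancelˡ-≡ (gcd j k) 1 q (trans (sym (gcd-scale j)) (trans gcd≡q (sym (ℕP.*-identityʳ q)))))) ,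
        refl
    image : map (ℕ._* q) T ↭ filterᵇ (λ i → order d i == k) (oneTo d)
    image = bijection⇒↭ (ℕ._* q) (filterᵇ-unique _ (oneTo-unique k)) (filterᵇ-unique _ (oneTo-unique d))
      into (λ _ _ → ℕP.*-cancelʳ-≡ _ _ q) onto

  ∑-by-order : (f : ℕ → ℚ) → ∑ (oneTo d) (f ∘ order d) ≡ ∑ (divisorsOf d) (λ k → fromℕ (φ k) * f k)
  ∑-by-order f = trans
    (∑-fibrewise _==_ (λ k → ==⁺ {k} refl) ==-≢ (oneTo d) (divisorsOf d) (order d) (divisorsOf-unique d) (λ {i} _ → ∈-divisorsOf⁺ 0<d (order∣ i)) f)
    (∑-cong (divisorsOf d) (λ {k} k∈ → cong (_* f k) (φ-count (∈-divisorsOf⁻ k∈))))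

-- Permutations and the action of the automorphism group on maps

-- Brings the enumeration into the form of a product of lists, for which membership and distinctness
-- are known.
allVecs-suc : {A : Set} (n : ℕ) (xs : List A) →
  allVecs (suc n) xs ≡ L.cartesianProductWith V._∷_ xs (allVecs n xs)
allVecs-suc n xs = go xs
  where
  -- The list of heads shrinks in the induction while the tails, which are also built from `xs`,
  -- stay fixed.
  go : ∀ ys → L.concatMap (λ x → map (x V.∷_) (allVecs n xs)) ys ≡ L.cartesianProductWith V._∷_ ys (allVecs n xs)
  go []       = refl
  go (y ∷ ys) = cong (map (y V.∷_) (allVecs n xs) ++_) (go ys)

∈-allVecs : {A : Set} {n : ℕ} {xs : List A} (v : Vec A n) → (∀ i → lookup v i ∈ xs) → v ∈ allVecs n xs
∈-allVecs V.[]      h = here refl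
∈-allVecs {n = suc n} {xs} (x V.∷ v) h = subst (x V.∷ v ∈_) (sym (allVecs-suc n xs))
  (∈-cartesianProductWith⁺ V._∷_ (h Fin.zero) (∈-allVecs v (h ∘ Fin.suc)))

allVecs-unique : {A : Set} (n : ℕ) {xs : List A} → Unique xs → Unique (allVecs n xs)
allVecs-unique zero    u = [] ∷ []
allVecs-unique (suc n) {xs} u = subst Unique (sym (allVecs-suc n xs))
  (Unique.cartesianProductWith⁺ V._∷_ VP.∷-injective u (allVecs-unique n u))

vec-ext : {A : Set} {n : ℕ} {v w : Vec A n} → (∀ i → lookup v i ≡ lookup w i) → v ≡ w
vec-ext {v = v} {w} h =
  trans (sym (VP.tabulate∘lookup v)) (trans (VP.tabulate-cong h) (VP.tabulate∘lookup w))

=ᶠ⁻ : ∀ {N} {u v : Fin N} → (u =ᶠ v) ≡ true → u ≡ v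
=ᶠ⁻ {u = u} {v} = ⌊⌋⁻ (u Fin.≟ v)

=ᶠ⁺ : ∀ {N} {u v : Fin N} → u ≡ v → (u =ᶠ v) ≡ true
=ᶠ⁺ {u = u} {v} = ⌊⌋⁺ (u Fin.≟ v)

=M⁻ : ∀ {N} {ρ σ : RotSys N} → (ρ =M σ) ≡ true → ρ ≡ σ
=M⁻ {ρ = ρ} {σ} = ⌊⌋⁻ (VP.≡-dec (VP.≡-dec Fin._≟_) ρ σ)

=M⁺ : ∀ {N} {ρ σ : RotSys N} → ρ ≡ σ → (ρ =M σ) ≡ true
=M⁺ {ρ = ρ} {σ} = ⌊⌋⁺ (VP.≡-dec (VP.≡-dec Fin._≟_) ρ σ)

=M-≢ : ∀ {N} {ρ σ : RotSys N} → ρ ≢ σ → (ρ =M σ) ≡ false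
=M-≢ {ρ = ρ} {σ} = ⌊⌋-no (VP.≡-dec (VP.≡-dec Fin._≟_) ρ σ)

Injective : {N : ℕ} → (Fin N → Fin N) → Set
Injective f = ∀ {u v} → f u ≡ f v → u ≡ v

⇒ᵇ⁻ : ∀ {a b} → not a ∨ b ≡ true → a ≡ true → b ≡ true
⇒ᵇ⁻ e refl = e

⇒ᵇ⁺ : ∀ {a b} → (a ≡ true → b ≡ true) → not a ∨ b ≡ true
⇒ᵇ⁺ {true}  h = h refl
⇒ᵇ⁺ {false} h = refl

allFin⁻ : ∀ {N} {p : Fin N → Bool} → all p (allFin N) ≡ true → ∀ v → p v ≡ true
allFin⁻ {p = p} e v = all⁻ {p = p} e (∈-allFin v)

allFin⁺ : ∀ {N} {p : Fin N → Bool} → (∀ v → p v ≡ true) → all p (allFin N) ≡ true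
allFin⁺ {N} h = all⁺ (allFin N) (λ {v} _ → h v)

isInjective⁻ : ∀ {N} {f : Fin N → Fin N} → isInjective f ≡ true → Injective f
isInjective⁻ e {u} {v} fu≡fv = =ᶠ⁻ (⇒ᵇ⁻ (allFin⁻ (allFin⁻ e u) v) (=ᶠ⁺ fu≡fv))

isInjective⁺ : ∀ {N} {f : Fin N → Fin N} → Injective f → isInjective f ≡ true
isInjective⁺ {f = f} inj = allFin⁺ (λ u → allFin⁺ {p = λ v → not (f u =ᶠ f v) ∨ (u =ᶠ v)}
  (λ v → ⇒ᵇ⁺ (λ e → =ᶠ⁺ (inj (=ᶠ⁻ e)))))

-- Pigeonhole: if w were missed, `punchOut` at w would turn f into an injection of N + 1 points into
-- N points.
injective⇒surjective : ∀ {N} {f : Fin N → Fin N} → Injective f → ∀ w → ∃ λ u → f u ≡ w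
injective⇒surjective {suc N} {f} inj w with FinP.any? (λ u → f u Fin.≟ w)
... | yes found = found
... | no missed = ⊥-elim (ℕP.<-irrefl refl (FinP.injective⇒≤ {f = λ u → Fin.punchOut (w≢ u)}
        (λ {u} {v} e → inj (FinP.punchOut-injective (w≢ u) (w≢ v) e))))
  where
  w≢ : ∀ u → w ≢ f u
  w≢ u w≡fu = missed (u , sym w≡fu)

record IsPermutation {N : ℕ} (γ : Perm N) : Set where
  constructor isPermutation
  field
    injective : Injective (app γ)

  surjective : ∀ w → ∃ λ u → app γ u ≡ w
  surjective = injective⇒surjective injective
open IsPermutation using (injective; surjective)

app-∘P : ∀ {N} (g h : Perm N) v → app (g ∘P h) v ≡ app g (app h v)
app-∘P g h v = VP.lookup∘tabulate _ v

app-idP : ∀ {N} (v : Fin N) → app idP v ≡ v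
app-idP v = VP.lookup-allFin v

-- By surjectivity the filter in `invApp` is never empty, so its default value `w` is not reached.
app-invApp : ∀ {N} {γ : Perm N} → IsPermutation γ → ∀ w → app γ (invApp γ w) ≡ w
app-invApp {N} {γ} (isPermutation inj) w with L.filterᵇ (λ u → app γ u =ᶠ w) (L.allFin N) in eq
... | []    = let u , γu≡w = injective⇒surjective inj w in
  ⊥-elim (¬Any[] (subst (u ∈_) eq (∈-filterᵇ⁺ (∈-allFin u) (=ᶠ⁺ γu≡w))))
... | u ∷ _ = =ᶠ⁻ (proj₂ (∈-filterᵇ⁻ {xs = allFin N} (subst (u ∈_) (sym eq) (here refl))))

invApp-app : ∀ {N} {γ : Perm N} → IsPermutation γ → ∀ v → invApp γ (app γ v) ≡ v
invApp-app {γ = γ} perm@(isPermutation inj) v = inj (app-invApp perm (app γ v))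

_⁻¹ : ∀ {N} → Perm N → Perm N
γ ⁻¹ = tabulate (invApp γ)

app-⁻¹ : ∀ {N} (γ : Perm N) v → app (γ ⁻¹) v ≡ invApp γ v
app-⁻¹ γ v = VP.lookup∘tabulate (invApp γ) v

∘P-inverseˡ : ∀ {N} {γ : Perm N} → IsPermutation γ → (γ ⁻¹) ∘P γ ≡ idP
∘P-inverseˡ {γ = γ} inj = vec-ext (λ v → trans (app-∘P (γ ⁻¹) γ v)
  (trans (app-⁻¹ γ _) (trans (invApp-app inj v) (sym (app-idP v)))))

∘P-inverseʳ : ∀ {N} {γ : Perm N} → IsPermutation γ → γ ∘P (γ ⁻¹) ≡ idP
∘P-inverseʳ {γ = γ} inj = vec-ext (λ v → trans (app-∘P γ (γ ⁻¹) v)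
  (trans (cong (app γ) (app-⁻¹ γ v)) (trans (app-invApp inj v) (sym (app-idP v)))))

∘P-assoc : ∀ {N} (f g h : Perm N) → (f ∘P g) ∘P h ≡ f ∘P (g ∘P h)
∘P-assoc f g h = vec-ext (λ v → begin
  app ((f ∘P g) ∘P h) v     ≡⟨ app-∘P (f ∘P g) h v ⟩
  app (f ∘P g) (app h v)    ≡⟨ app-∘P f g (app h v) ⟩
  app f (app g (app h v))   ≡⟨ cong (app f) (app-∘P g h v) ⟨
  app f (app (g ∘P h) v)    ≡⟨ app-∘P f (g ∘P h) v ⟨
  app (f ∘P (g ∘P h)) v     ∎)
  where open ≡-Reasoning

∘P-identityˡ : ∀ {N} (g : Perm N) → idP ∘P g ≡ g
∘P-identityˡ g = vec-ext (λ v → trans (app-∘P idP g v) (app-idP _))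

∘P-identityʳ : ∀ {N} (g : Perm N) → g ∘P idP ≡ g
∘P-identityʳ g = vec-ext (λ v → trans (app-∘P g idP v) (cong (app g) (app-idP v)))

rot-ext : ∀ {N} {ρ σ : RotSys N} → (∀ w x → rot ρ w x ≡ rot σ w x) → ρ ≡ σ
rot-ext h = vec-ext (λ w → vec-ext (h w))

-- The relation ρ'_{γ(w)} γ = γ ρ_w, free of inverses. All further properties of `act` are derived
-- from it.
rot-act : ∀ {N} {γ : Perm N} → IsPermutation γ → ∀ ρ w x →
  rot (act γ ρ) (app γ w) (app γ x) ≡ app γ (rot ρ w x)
rot-act {γ = γ} inj ρ w x = begin
  rot (act γ ρ) (app γ w) (app γ x)
    ≡⟨ cong (λ r → lookup r (app γ x)) (VP.lookup∘tabulate _ (app γ w)) ⟩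
  lookup (tabulate (λ y → app γ (rot ρ (invApp γ (app γ w)) (invApp γ y)))) (app γ x)
    ≡⟨ VP.lookup∘tabulate _ (app γ x) ⟩
  app γ (rot ρ (invApp γ (app γ w)) (invApp γ (app γ x)))
    ≡⟨ cong (app γ) (cong₂ (rot ρ) (invApp-app inj w) (invApp-app inj x)) ⟩
  app γ (rot ρ w x) ∎
  where open ≡-Reasoning

-- Every pair of vertices has the form (γ w, γ x), so the relation of `rot-act` determines the image
-- map. Composites and the identity can then be checked without computing an inverse.
act-unique : ∀ {N} {γ : Perm N} → IsPermutation γ → ∀ ρ {σ} →
  (∀ w x → rot σ (app γ w) (app γ x) ≡ app γ (rot ρ w x)) → act γ ρ ≡ σ
act-unique {γ = γ} inj ρ {σ} h = rot-ext same
  where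
  same : ∀ w x → rot (act γ ρ) w x ≡ rot σ w x
  same w x with surjective inj w | surjective inj x
  ... | w′ , refl | x′ , refl = trans (rot-act inj ρ w′ x′) (sym (h w′ x′))

∘P-permutation : ∀ {N} {g h : Perm N} → IsPermutation g → IsPermutation h → IsPermutation (g ∘P h)
∘P-permutation {g = g} {h} (isPermutation ig) (isPermutation ih) =
  isPermutation (λ e → ih (ig (trans (sym (app-∘P g h _)) (trans e (app-∘P g h _)))))

act-∘P : ∀ {N} {g h : Perm N} → IsPermutation g → IsPermutation h → ∀ ρ →
  act (g ∘P h) ρ ≡ act g (act h ρ)
act-∘P {g = g} {h} ig ih ρ = act-unique (∘P-permutation ig ih) ρ (λ w x → begin
  rot (act g (act h ρ)) (app (g ∘P h) w) (app (g ∘P h) x)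
    ≡⟨ cong₂ (rot (act g (act h ρ))) (app-∘P g h w) (app-∘P g h x) ⟩
  rot (act g (act h ρ)) (app g (app h w)) (app g (app h x))
    ≡⟨ rot-act ig (act h ρ) (app h w) (app h x) ⟩
  app g (rot (act h ρ) (app h w) (app h x))
    ≡⟨ cong (app g) (rot-act ih ρ w x) ⟩
  app g (app h (rot ρ w x))
    ≡⟨ app-∘P g h _ ⟨
  app (g ∘P h) (rot ρ w x) ∎)
  where open ≡-Reasoning

idP-permutation : ∀ {N} → IsPermutation (idP {N})
idP-permutation = isPermutation (λ e → trans (sym (app-idP _)) (trans e (app-idP _)))

act-idP : ∀ {N} (ρ : RotSys N) → act idP ρ ≡ ρ
act-idP ρ = act-unique idP-permutation ρ (λ w x →
  trans (cong₂ (rot ρ) (app-idP w) (app-idP x)) (sym (app-idP _)))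

⁻¹-permutation : ∀ {N} {γ : Perm N} → IsPermutation γ → IsPermutation (γ ⁻¹)
⁻¹-permutation {γ = γ} inj = isPermutation (λ {u} {v} e → trans (sym (app-invApp inj u))
  (trans (cong (app γ) (trans (sym (app-⁻¹ γ u)) (trans e (app-⁻¹ γ v)))) (app-invApp inj v)))

act-⁻¹ : ∀ {N} {γ : Perm N} → IsPermutation γ → ∀ {ρ σ} → act γ ρ ≡ σ → act (γ ⁻¹) σ ≡ ρ
act-⁻¹ {γ = γ} inj {ρ} e = trans (cong (act (γ ⁻¹)) (sym e)) (trans (sym (act-∘P (⁻¹-permutation inj) inj ρ))
  (trans (cong (λ g → act g ρ) (∘P-inverseˡ inj)) (act-idP ρ)))

act-injective : ∀ {N} {γ : Perm N} → IsPermutation γ → ∀ {ρ σ} → act γ ρ ≡ act γ σ → ρ ≡ σ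
act-injective inj {ρ} {σ} e = trans (sym (act-⁻¹ inj {ρ} refl)) (act-⁻¹ inj {σ} (sym e))

⟦⟧-∧ : ∀ x y → ⟦ x ⟧ * ⟦ y ⟧ ≡ ⟦ x ∧ y ⟧
⟦⟧-∧ true  y = ℚP.*-identityˡ ⟦ y ⟧
⟦⟧-∧ false y = ℚP.*-zeroˡ ⟦ y ⟧

-- Read p, s, a, b as: σ has the property, lies in the orbit of the current map, of a later one, of
-- one already seen; p₀ and b₀ are p and b for the current map. If s holds, σ is counted now or
-- never, according to whether the current map is new. If not, adding the current map to the seen
-- ones changes nothing for σ.
indicator-split : ∀ p s a b p₀ b₀ → (s ≡ true → p ≡ p₀ × b ≡ b₀) →
  ⟦ p ⟧ * ⟦ (s ∨ a) ∧ not b ⟧ ≡ ⟦ p₀ ∧ not b₀ ⟧ * ⟦ s ⟧ + ⟦ p ⟧ * ⟦ a ∧ not (s ∨ b) ⟧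
indicator-split p false a b p₀ b₀ _ =
  sym (trans (cong (_+ ⟦ p ⟧ * ⟦ a ∧ not b ⟧) (ℚP.*-zeroʳ ⟦ p₀ ∧ not b₀ ⟧)) (ℚP.+-identityˡ _))
indicator-split p true a b p₀ b₀ h with refl , refl ← h refl = trans (⟦⟧-∧ p (not b))
  (sym (trans (cong₂ _+_ (ℚP.*-identityʳ ⟦ p ∧ not b ⟧)
          (trans (cong (λ c → ⟦ p ⟧ * ⟦ c ⟧) (BoolP.∧-zeroʳ a)) (ℚP.*-zeroʳ ⟦ p ⟧)))
        (ℚP.+-identityʳ ⟦ p ∧ not b ⟧)))

-- The automorphism group, its orbits of maps and their stabilizers

module _ {N : ℕ} (G : Graph N) where

  private
    Γ = Aut G
    𝓜 = allMaps G

  record Automorphism (g : Perm N) : Set where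
    constructor automorphism
    field
      permutation : IsPermutation g
      preserves : ∀ u v → adj G (app g u) (app g v) ≡ adj G u v
  open Automorphism using (permutation; preserves)

  ∈Aut⁻ : ∀ {g} → g ∈ Γ → Automorphism g
  ∈Aut⁻ {g} g∈ with ∈-filterᵇ⁻ {xs = allPerms N} g∈
  ... | g∈P , pres with ∈-filterᵇ⁻ {p = λ g → isInjective (app g)} {xs = allVecs N (allFin N)} g∈P
  ...   | _ , inj = automorphism (isPermutation (isInjective⁻ inj))
            (λ u v → ⌊⌋⁻ (Bool._≟_ (adj G (app g u) (app g v)) (adj G u v)) (allFin⁻ (allFin⁻ pres u) v))

  ∈Aut⁺ : ∀ {g} → Automorphism g → g ∈ Γ
  ∈Aut⁺ {g} (automorphism (isPermutation inj) pres) =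
    ∈-filterᵇ⁺ (∈-filterᵇ⁺ (∈-allVecs g (λ i → ∈-allFin (lookup g i))) (isInjective⁺ inj))
      (allFin⁺ (λ u → allFin⁺ (λ v → ⌊⌋⁺ (Bool._≟_ (adj G (app g u) (app g v)) (adj G u v)) (pres u v))))

  Aut-unique : Unique Γ
  Aut-unique = filterᵇ-unique (isAut G) (filterᵇ-unique _ (allVecs-unique N (Unique.allFin⁺ N)))

  Aut-permutation : ∀ {g} → g ∈ Γ → IsPermutation g
  Aut-permutation g∈ = permutation (∈Aut⁻ g∈)

  Aut-id : idP ∈ Γ
  Aut-id = ∈Aut⁺ (automorphism idP-permutation (λ u v → cong₂ (adj G) (app-idP u) (app-idP v)))

  Aut-∘ : ∀ {g h} → g ∈ Γ → h ∈ Γ → g ∘P h ∈ Γ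
  Aut-∘ {g} {h} g∈ h∈ with ∈Aut⁻ g∈ | ∈Aut⁻ h∈
  ... | automorphism ig pg | automorphism ih ph = ∈Aut⁺ (automorphism (∘P-permutation ig ih)
    (λ u v → trans (cong₂ (adj G) (app-∘P g h u) (app-∘P g h v)) (trans (pg _ _) (ph u v))))

  Aut-⁻¹ : ∀ {g} → g ∈ Γ → g ⁻¹ ∈ Γ
  Aut-⁻¹ {g} g∈ with ∈Aut⁻ g∈
  ... | automorphism ig pg = ∈Aut⁺ (automorphism (⁻¹-permutation ig)
    (λ u v → trans (cong₂ (adj G) (app-⁻¹ g u) (app-⁻¹ g v))
      (trans (sym (pg _ _)) (cong₂ (adj G) (app-invApp ig u) (app-invApp ig v)))))

  Aut-nonempty : 0 < length Γ
  Aut-nonempty = ∈-length Aut-id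

  record Rotation (r : Fin N → Fin N) (v : Fin N) : Set where
    constructor rotation
    field
      injective  : Injective r
      inside     : ∀ u → adj G v u ≡ true → adj G v (r u) ≡ true
      outside    : ∀ u → adj G v u ≡ false → r u ≡ u
      transitive : ∀ u w → adj G v u ≡ true → adj G v w ≡ true → ∃ λ k → k < N × iter r k u ≡ w

  isRotationAt⁻ : ∀ {r v} → isRotationAt G r v ≡ true → Rotation r v
  isRotationAt⁻ {r} {v} e with ∧⁻ {isInjective r} e
  ... | inj , rest with ∧⁻ {all (λ u → if adj G v u then adj G v (r u) else (r u =ᶠ u)) (L.allFin N)} rest
  ...   | inout , trans′ = rotation (isInjective⁻ inj)
            (λ u vu → subst (λ b → (if b then adj G v (r u) else (r u =ᶠ u)) ≡ true) vu (allFin⁻ inout u))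
            (λ u ¬vu → =ᶠ⁻ (subst (λ b → (if b then adj G v (r u) else (r u =ᶠ u)) ≡ true) ¬vu (allFin⁻ inout u)))
            (λ u w vu vw → let k , k∈ , ek = any⁻ (upTo N) (⇒ᵇ⁻ (allFin⁻ (allFin⁻ trans′ u) w) (∧⁺ vu vw))
                           in k , ∈-upTo⁻ k∈ , =ᶠ⁻ ek)

  isRotationAt⁺ : ∀ {r v} → Rotation r v → isRotationAt G r v ≡ true
  isRotationAt⁺ {r} {v} (rotation inj ins out tr) =
    ∧⁺ (isInjective⁺ inj) (∧⁺ (allFin⁺ inout) (allFin⁺ (λ u → allFin⁺ (λ w → ⇒ᵇ⁺ (reach u w)))))
    where
    inout : ∀ u → (if adj G v u then adj G v (r u) else (r u =ᶠ u)) ≡ true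
    inout u with adj G v u in eq
    ... | true  = ins u eq
    ... | false = =ᶠ⁺ (out u eq)
    reach : ∀ u w → (adj G v u ∧ adj G v w) ≡ true → any (λ k → iter r k u =ᶠ w) (L.upTo N) ≡ true
    reach u w e = let vu , vw = ∧⁻ {adj G v u} e
                      k , k<N , ek = tr u w vu vw
                  in any⁺ (∈-upTo⁺ k<N) (=ᶠ⁺ ek)

  -- Since γ N(v) = N(γ v), conjugation by γ takes a rotation at v to one at γ v. Iterates are
  -- conjugated as well, so the result is again a single cycle on the neighbourhood.
  act-isMap : ∀ {γ ρ} → γ ∈ Γ → isMap G ρ ≡ true → isMap G (act γ ρ) ≡ true
  act-isMap {γ} {ρ} γ∈ ρ-map = allFin⁺ at
    where
    perm = Aut-permutation γ∈
    inj = injective perm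
    pres = preserves (∈Aut⁻ γ∈)
    conj : ∀ v → Rotation (rot ρ v) v → Rotation (rot (act γ ρ) (app γ v)) (app γ v)
    conj v (rotation injᵣ ins out tr) = rotation inj′ ins′ out′ tr′
      where
      onto = surjective perm
      R = rot (act γ ρ) (app γ v)
      R-γ : ∀ x → R (app γ x) ≡ app γ (rot ρ v x)
      R-γ = rot-act perm ρ v
      iter-R : ∀ k x → iter R k (app γ x) ≡ app γ (iter (rot ρ v) k x)
      iter-R zero    x = refl
      iter-R (suc k) x = trans (cong R (iter-R k x)) (R-γ _)
      inj′ : Injective R
      inj′ {u} {w} e with onto u | onto w
      ... | x , refl | y , refl = cong (app γ) (injᵣ (inj (trans (sym (R-γ x)) (trans e (R-γ y)))))
      ins′ : ∀ u → adj G (app γ v) u ≡ true → adj G (app γ v) (R u) ≡ true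
      ins′ u vu with onto u
      ... | x , refl = trans (cong (adj G (app γ v)) (R-γ x)) (trans (pres v _) (ins x (trans (sym (pres v x)) vu)))
      out′ : ∀ u → adj G (app γ v) u ≡ false → R u ≡ u
      out′ u ¬vu with onto u
      ... | x , refl = trans (R-γ x) (cong (app γ) (out x (trans (sym (pres v x)) ¬vu)))
      tr′ : ∀ u w → adj G (app γ v) u ≡ true → adj G (app γ v) w ≡ true → ∃ λ k → k < N × iter R k u ≡ w
      tr′ u w vu vw with onto u | onto w
      ... | x , refl | y , refl with tr x y (trans (sym (pres v x)) vu) (trans (sym (pres v y)) vw)
      ...   | k , k<N , e = k , k<N , trans (iter-R k x) (cong (app γ) e)
    at : ∀ w → isRotationAt G (rot (act γ ρ) w) w ≡ true
    at w with surjective perm w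
    ... | v , refl = isRotationAt⁺ (conj v (isRotationAt⁻ (allFin⁻ ρ-map v)))

  ∈allMaps⁻ : ∀ {ρ} → ρ ∈ 𝓜 → isMap G ρ ≡ true
  ∈allMaps⁻ ρ∈ = proj₂ (∈-filterᵇ⁻ {xs = allVecs N (allVecs N (allFin N))} ρ∈)

  ∈allMaps⁺ : ∀ {ρ} → isMap G ρ ≡ true → ρ ∈ 𝓜
  ∈allMaps⁺ {ρ} = ∈-filterᵇ⁺ (∈-allVecs ρ (λ v → ∈-allVecs (lookup ρ v) (λ i → ∈-allFin _)))

  allMaps-unique : Unique 𝓜
  allMaps-unique = filterᵇ-unique (isMap G) (allVecs-unique N (allVecs-unique N (Unique.allFin⁺ N)))

  act-∈ : ∀ {γ ρ} → γ ∈ Γ → ρ ∈ 𝓜 → act γ ρ ∈ 𝓜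
  act-∈ {γ} {ρ} γ∈ ρ∈ = ∈allMaps⁺ (act-isMap {γ} {ρ} γ∈ (∈allMaps⁻ ρ∈))

  ∈stab⁻ : ∀ {h ρ} → h ∈ stab G ρ → h ∈ Γ × act h ρ ≡ ρ
  ∈stab⁻ h∈ with ∈-filterᵇ⁻ {xs = Γ} h∈
  ... | h∈Γ , e = h∈Γ , =M⁻ e

  ∈stab⁺ : ∀ {h ρ} → h ∈ Γ → act h ρ ≡ ρ → h ∈ stab G ρ
  ∈stab⁺ h∈ e = ∈-filterᵇ⁺ h∈ (=M⁺ e)

  stab-unique : ∀ ρ → Unique (stab G ρ)
  stab-unique ρ = filterᵇ-unique _ Aut-unique

  length-stab : ∀ ρ → fromℕ (length (stab G ρ)) ≡ ∑ Γ (λ h → ⟦ act h ρ =M ρ ⟧)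
  length-stab ρ = fromℕ-count (λ h → act h ρ =M ρ) Γ

  ∑-left-translate : ∀ {γ} → γ ∈ Γ → (f : Perm N → ℚ) → ∑ Γ (λ h → f (γ ∘P h)) ≡ ∑ Γ f
  ∑-left-translate {γ} γ∈ = ∑-bijection (γ ∘P_) Aut-unique Aut-unique (Aut-∘ γ∈)
    (λ {g} {h} _ _ e → trans (sym (cancel g)) (trans (cong ((γ ⁻¹) ∘P_) e) (cancel h)))
    (λ {g} g∈ → (γ ⁻¹) ∘P g , Aut-∘ (Aut-⁻¹ γ∈) g∈ ,
      trans (sym (∘P-assoc γ (γ ⁻¹) g)) (trans (cong (_∘P g) (∘P-inverseʳ inj)) (∘P-identityˡ g)))
    where
    inj = Aut-permutation γ∈
    cancel : ∀ g → (γ ⁻¹) ∘P (γ ∘P g) ≡ g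
    cancel g = trans (sym (∘P-assoc (γ ⁻¹) γ g)) (trans (cong (_∘P g) (∘P-inverseˡ inj)) (∘P-identityˡ g))

  ∑-right-translate : ∀ {γ} → γ ∈ Γ → (f : Perm N → ℚ) → ∑ Γ (λ h → f (h ∘P γ)) ≡ ∑ Γ f
  ∑-right-translate {γ} γ∈ = ∑-bijection (_∘P γ) Aut-unique Aut-unique (λ h∈ → Aut-∘ h∈ γ∈)
    (λ {g} {h} _ _ e → trans (sym (cancel g)) (trans (cong (_∘P (γ ⁻¹)) e) (cancel h)))
    (λ {g} g∈ → g ∘P (γ ⁻¹) , Aut-∘ g∈ (Aut-⁻¹ γ∈) ,
      trans (∘P-assoc g (γ ⁻¹) γ) (trans (cong (g ∘P_) (∘P-inverseˡ inj)) (∘P-identityʳ g)))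
    where
    inj = Aut-permutation γ∈
    cancel : ∀ g → (g ∘P γ) ∘P (γ ⁻¹) ≡ g
    cancel g = trans (∘P-assoc g γ (γ ⁻¹)) (trans (cong (g ∘P_) (∘P-inverseʳ inj)) (∘P-identityʳ g))

  -- The automorphisms taking ρ to σ form the left coset of the stabilizer of ρ by γ.
  transporter-left : ∀ {γ ρ σ} → γ ∈ Γ → act γ ρ ≡ σ →
    ∑ Γ (λ h → ⟦ act h ρ =M σ ⟧) ≡ fromℕ (length (stab G ρ))
  transporter-left {γ} {ρ} {σ} γ∈ γρ≡σ = begin
    ∑ Γ (λ h → ⟦ act h ρ =M σ ⟧)          ≡⟨ ∑-left-translate γ∈ _ ⟨
    ∑ Γ (λ h → ⟦ act (γ ∘P h) ρ =M σ ⟧)   ≡⟨ ∑-cong Γ (λ h∈ → cong ⟦_⟧ (same h∈)) ⟩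
    ∑ Γ (λ h → ⟦ act h ρ =M ρ ⟧)          ≡⟨ length-stab ρ ⟨
    fromℕ (length (stab G ρ))             ∎
    where
    open ≡-Reasoning
    perm = Aut-permutation γ∈
    same : ∀ {h} → h ∈ Γ → (act (γ ∘P h) ρ =M σ) ≡ (act h ρ =M ρ)
    same {h} h∈ = Bool-ext
      (λ e → =M⁺ (act-injective perm (trans (sym γhρ) (trans (=M⁻ e) (sym γρ≡σ)))))
      (λ e → =M⁺ (trans γhρ (trans (cong (act γ) (=M⁻ e)) γρ≡σ)))
      where
      γhρ : act (γ ∘P h) ρ ≡ act γ (act h ρ)
      γhρ = act-∘P perm (Aut-permutation h∈) ρ

  -- The same automorphisms form the right coset of the stabilizer of σ by γ. Compared with the left
  -- coset, this gives equal stabilizer orders along an orbit without conjugating one stabilizer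
  -- onto the other.
  transporter-right : ∀ {γ ρ σ} → γ ∈ Γ → act γ ρ ≡ σ →
    ∑ Γ (λ h → ⟦ act h ρ =M σ ⟧) ≡ fromℕ (length (stab G σ))
  transporter-right {γ} {ρ} {σ} γ∈ γρ≡σ = begin
    ∑ Γ (λ h → ⟦ act h ρ =M σ ⟧)          ≡⟨ ∑-right-translate γ∈ _ ⟨
    ∑ Γ (λ h → ⟦ act (h ∘P γ) ρ =M σ ⟧)   ≡⟨ ∑-cong Γ (λ {h} h∈ → cong (λ τ → ⟦ τ =M σ ⟧)
                                               (trans (act-∘P (Aut-permutation h∈) (Aut-permutation γ∈) ρ)
                                                      (cong (act h) γρ≡σ))) ⟩
    ∑ Γ (λ h → ⟦ act h σ =M σ ⟧)          ≡⟨ length-stab σ ⟨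
    fromℕ (length (stab G σ))             ∎
    where open ≡-Reasoning

  record _∼_ (ρ σ : RotSys N) : Set where
    constructor moved-by
    field
      {mover} : Perm N
      mover∈  : mover ∈ Γ
      moves   : act mover ρ ≡ σ
  open _∼_

  sameOrbit⁻ : ∀ ρ σ → sameOrbit G ρ σ ≡ true → ρ ∼ σ
  sameOrbit⁻ ρ σ e with any⁻ {p = λ γ → act γ ρ =M σ} Γ e
  ... | γ , γ∈ , eq = moved-by γ∈ (=M⁻ eq)

  sameOrbit⁺ : ∀ {ρ σ} → ρ ∼ σ → sameOrbit G ρ σ ≡ true
  sameOrbit⁺ {ρ} {σ} (moved-by γ∈ e) = any⁺ {p = λ γ → act γ ρ =M σ} γ∈ (=M⁺ e)

  ∼-refl : ∀ {ρ} → ρ ∼ ρ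
  ∼-refl {ρ} = moved-by Aut-id (act-idP ρ)

  ∼-sym : ∀ {ρ σ} → ρ ∼ σ → σ ∼ ρ
  ∼-sym (moved-by γ∈ e) = moved-by (Aut-⁻¹ γ∈) (act-⁻¹ (Aut-permutation γ∈) e)

  ∼-trans : ∀ {ρ σ τ} → ρ ∼ σ → σ ∼ τ → ρ ∼ τ
  ∼-trans {ρ} (moved-by γ∈ γρ≡σ) (moved-by {δ} δ∈ δσ≡τ) = moved-by (Aut-∘ δ∈ γ∈)
    (trans (act-∘P (Aut-permutation δ∈) (Aut-permutation γ∈) ρ) (trans (cong (act δ) γρ≡σ) δσ≡τ))

  sameOrbit-comm : ∀ ρ σ → sameOrbit G ρ σ ≡ sameOrbit G σ ρ
  sameOrbit-comm ρ σ = Bool-ext (λ e → sameOrbit⁺ (∼-sym (sameOrbit⁻ ρ σ e)))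
                                (λ e → sameOrbit⁺ (∼-sym (sameOrbit⁻ σ ρ e)))

  length-stab-invariant : ∀ {ρ σ} → ρ ∼ σ → length (stab G ρ) ≡ length (stab G σ)
  length-stab-invariant {ρ} {σ} (moved-by γ∈ e) = fromℕ-injective {length (stab G ρ)} {length (stab G σ)}
    (trans (sym (transporter-left {ρ = ρ} {σ} γ∈ e)) (transporter-right {ρ = ρ} {σ} γ∈ e))

  transporter-size : ∀ ρ σ →
    ∑ Γ (λ γ → ⟦ act γ ρ =M σ ⟧) ≡ fromℕ (length (stab G ρ)) * ⟦ sameOrbit G ρ σ ⟧
  transporter-size ρ σ = go (sameOrbit G ρ σ) refl
    where
    s = fromℕ (length (stab G ρ))
    go : ∀ b → sameOrbit G ρ σ ≡ b → ∑ Γ (λ γ → ⟦ act γ ρ =M σ ⟧) ≡ s * ⟦ b ⟧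
    go true  e = let ρ∼σ = sameOrbit⁻ ρ σ e in
      trans (transporter-left {ρ = ρ} {σ} (mover∈ ρ∼σ) (moves ρ∼σ)) (sym (ℚP.*-identityʳ s))
    go false e = trans
      (∑-0 Γ (λ {γ} γ∈ → cong ⟦_⟧ (=M-≢ {ρ = act γ ρ} {σ}
        (λ γρ≡σ → false≢true (trans (sym e) (sameOrbit⁺ {ρ} {σ} (moved-by γ∈ γρ≡σ)))))))
      (sym (ℚP.*-zeroʳ s))

  -- Γ is sorted by the image of ρ: the fibre over σ has as many elements as the stabilizer of ρ, or
  -- none if σ lies outside the orbit.
  orbit-stabilizer : ∀ {ρ} → ρ ∈ 𝓜 →
    fromℕ (length Γ) ≡ fromℕ (length (stab G ρ)) * ∑ 𝓜 (λ σ → ⟦ sameOrbit G ρ σ ⟧)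
  orbit-stabilizer {ρ} ρ∈ =
    trans (fromℕ-length Γ)
    (trans (∑-fibrewise _=M_ (λ σ → =M⁺ {ρ = σ} refl) =M-≢ Γ 𝓜 (λ γ → act γ ρ) allMaps-unique
             (λ {γ} γ∈ → act-∈ {γ} {ρ} γ∈ ρ∈) (λ _ → 1ℚ))
    (trans (∑-cong 𝓜 (λ {σ} _ → trans (ℚP.*-identityʳ (∑ Γ (λ γ → ⟦ act γ ρ =M σ ⟧))) (transporter-size ρ σ)))
           (sym (∑-*ˡ 𝓜 (fromℕ (length (stab G ρ))) (λ σ → ⟦ sameOrbit G ρ σ ⟧)))))

  inOrbitOf : List (RotSys N) → RotSys N → Bool
  inOrbitOf xs σ = any (sameOrbit G σ) xs

  inOrbitOf-invariant : ∀ xs {ρ σ} → σ ∼ ρ → inOrbitOf xs σ ≡ inOrbitOf xs ρ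
  inOrbitOf-invariant xs {ρ} {σ} σ∼ρ = Bool-ext (transfer (∼-sym σ∼ρ)) (transfer σ∼ρ)
    where
    transfer : ∀ {σ ρ} → ρ ∼ σ → inOrbitOf xs σ ≡ true → inOrbitOf xs ρ ≡ true
    transfer {σ} {ρ} ρ∼σ e with any⁻ {p = sameOrbit G σ} xs e
    ... | τ , τ∈ , σ∼τ = any⁺ {p = sameOrbit G ρ} τ∈ (sameOrbit⁺ (∼-trans ρ∼σ (sameOrbit⁻ σ τ σ∼τ)))

  -- The maps σ ∈ P lying in the orbit of xs but not of seen are partitioned by the orbits that
  -- orbitCount counts, each of size |Γ| / d.
  orbitCount-formula : (P : RotSys N → Bool) (d : ℕ) →
    (∀ {ρ σ} → ρ ∈ 𝓜 → σ ∈ 𝓜 → σ ∼ ρ → P σ ≡ P ρ) →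
    (∀ {ρ} → ρ ∈ 𝓜 → P ρ ≡ true → length (stab G ρ) ≡ d) →
    ∀ seen xs → (∀ {ρ} → ρ ∈ xs → ρ ∈ 𝓜) →
    fromℕ (length Γ) * fromℕ (orbitCount G P seen xs)
      ≡ fromℕ d * ∑ 𝓜 (λ σ → ⟦ P σ ⟧ * ⟦ inOrbitOf xs σ ∧ not (inOrbitOf seen σ) ⟧)
  orbitCount-formula P d P-inv P-stab seen [] xs⊆ = trans (ℚP.*-zeroʳ (fromℕ (length Γ)))
    (sym (trans (cong (fromℕ d *_) (∑-0 𝓜 (λ {σ} _ → ℚP.*-zeroʳ ⟦ P σ ⟧))) (ℚP.*-zeroʳ (fromℕ d))))
  orbitCount-formula P d P-inv P-stab seen (ρ ∷ xs) xs⊆ = begin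
    |Γ| * fromℕ ((if new then 1 else 0) ℕ.+ rest)
      ≡⟨ cong (|Γ| *_) (trans (fromℕ-+ (if new then 1 else 0) rest) (cong (_+ fromℕ rest) (fromℕ-if new))) ⟩
    |Γ| * (⟦ new ⟧ + fromℕ rest)
      ≡⟨ ℚP.*-distribˡ-+ |Γ| ⟦ new ⟧ (fromℕ rest) ⟩
    |Γ| * ⟦ new ⟧ + |Γ| * fromℕ (rest)
      ≡⟨ cong₂ _+_ first (orbitCount-formula P d P-inv P-stab (ρ ∷ seen) xs (xs⊆ ∘ there)) ⟩
    fromℕ d * ∑ 𝓜 now + fromℕ d * ∑ 𝓜 later
      ≡⟨ ℚP.*-distribˡ-+ (fromℕ d) (∑ 𝓜 now) (∑ 𝓜 later) ⟨
    fromℕ d * (∑ 𝓜 now + ∑ 𝓜 later)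
      ≡⟨ cong (fromℕ d *_) (∑-+ 𝓜 now later) ⟨
    fromℕ d * ∑ 𝓜 (λ σ → now σ + later σ)
      ≡⟨ cong (fromℕ d *_) (∑-cong 𝓜 (λ {σ} σ∈ → sym (split {σ} σ∈))) ⟩
    fromℕ d * ∑ 𝓜 (λ σ → ⟦ P σ ⟧ * ⟦ inOrbitOf (ρ ∷ xs) σ ∧ not (inOrbitOf seen σ) ⟧) ∎
    where
    open ≡-Reasoning
    |Γ| = fromℕ (length Γ)
    ρ∈ = xs⊆ (here refl)
    rest = orbitCount G P (ρ ∷ seen) xs
    new = P ρ ∧ not (inOrbitOf seen ρ)
    now later : RotSys N → ℚ
    now σ = ⟦ new ⟧ * ⟦ sameOrbit G σ ρ ⟧
    later σ = ⟦ P σ ⟧ * ⟦ inOrbitOf xs σ ∧ not (inOrbitOf (ρ ∷ seen) σ) ⟧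
    fromℕ-if : ∀ b → fromℕ (if b then 1 else 0) ≡ ⟦ b ⟧
    fromℕ-if true  = refl
    fromℕ-if false = refl
    both-zero : |Γ| * 0ℚ ≡ fromℕ d * ∑ 𝓜 (λ σ → 0ℚ * ⟦ sameOrbit G σ ρ ⟧)
    both-zero = trans (ℚP.*-zeroʳ |Γ|) (sym (trans (cong (fromℕ d *_)
      (∑-0 𝓜 (λ {σ} _ → ℚP.*-zeroˡ ⟦ sameOrbit G σ ρ ⟧))) (ℚP.*-zeroʳ (fromℕ d))))
    first : |Γ| * ⟦ new ⟧ ≡ fromℕ d * ∑ 𝓜 now
    first = go (P ρ) (not (inOrbitOf seen ρ)) refl
      where
      go : ∀ p q → P ρ ≡ p → |Γ| * ⟦ p ∧ q ⟧ ≡ fromℕ d * ∑ 𝓜 (λ σ → ⟦ p ∧ q ⟧ * ⟦ sameOrbit G σ ρ ⟧)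
      go true true Pρ = trans (ℚP.*-identityʳ |Γ|) (trans (orbit-stabilizer ρ∈)
        (cong₂ (λ s t → fromℕ s * t) (P-stab ρ∈ Pρ)
          (∑-cong 𝓜 (λ {σ} _ → trans (cong ⟦_⟧ (sameOrbit-comm ρ σ)) (sym (ℚP.*-identityˡ ⟦ sameOrbit G σ ρ ⟧))))))
      go true false _ = both-zero
      go false _    _ = both-zero
    split : ∀ {σ} → σ ∈ 𝓜 →
      ⟦ P σ ⟧ * ⟦ inOrbitOf (ρ ∷ xs) σ ∧ not (inOrbitOf seen σ) ⟧ ≡ now σ + later σ
    split {σ} σ∈ = indicator-split (P σ) (sameOrbit G σ ρ) (inOrbitOf xs σ) (inOrbitOf seen σ) (P ρ) (inOrbitOf seen ρ)
      (λ e → let σ∼ρ = sameOrbit⁻ σ ρ e in P-inv {ρ} {σ} ρ∈ σ∈ σ∼ρ , inOrbitOf-invariant seen {ρ} {σ} σ∼ρ)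

  -- With nothing seen and all maps still ahead, the condition on orbits holds for every map,
  -- because each lies in its own orbit.
  orbitCount-total : (P : RotSys N → Bool) (d : ℕ) →
    (∀ {ρ σ} → ρ ∈ 𝓜 → σ ∈ 𝓜 → σ ∼ ρ → P σ ≡ P ρ) →
    (∀ {ρ} → ρ ∈ 𝓜 → P ρ ≡ true → length (stab G ρ) ≡ d) →
    fromℕ (length Γ) * fromℕ (orbitCount G P [] 𝓜) ≡ fromℕ d * ∑ 𝓜 (λ σ → ⟦ P σ ⟧)
  orbitCount-total P d P-inv P-stab = trans (orbitCount-formula P d P-inv P-stab [] 𝓜 id)
    (cong (fromℕ d *_) (∑-cong 𝓜 (λ {σ} σ∈ → trans
      (cong (λ b → ⟦ P σ ⟧ * ⟦ b ∧ true ⟧) (any⁺ {p = sameOrbit G σ} σ∈ (sameOrbit⁺ (∼-refl {σ}))))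
      (ℚP.*-identityʳ ⟦ P σ ⟧))))

-- Powers, cycle lengths and cycle types

pow-+ : ∀ {N} (g : Perm N) i j → pow g (i ℕ.+ j) ≡ pow g i ∘P pow g j
pow-+ g zero    j = sym (∘P-identityˡ (pow g j))
pow-+ g (suc i) j = trans (cong (g ∘P_) (pow-+ g i j)) (sym (∘P-assoc g (pow g i) (pow g j)))

pow-* : ∀ {N} (g : Perm N) i k → pow (pow g i) k ≡ pow g (k ℕ.* i)
pow-* g i zero    = refl
pow-* g i (suc k) = trans (cong (pow g i ∘P_) (pow-* g i k)) (sym (pow-+ g i (k ℕ.* i)))

app-pow-+ : ∀ {N} (g : Perm N) i j v → app (pow g (i ℕ.+ j)) v ≡ app (pow g i) (app (pow g j) v)
app-pow-+ g i j v = trans (cong (λ h → app h v) (pow-+ g i j)) (app-∘P (pow g i) (pow g j) v)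

app-pow-multiple : ∀ {N} (g : Perm N) d {v} → app (pow g d) v ≡ v → ∀ k → app (pow g (k ℕ.* d)) v ≡ v
app-pow-multiple g d {v} e zero    = app-idP v
app-pow-multiple g d {v} e (suc k) =
  trans (app-pow-+ g d (k ℕ.* d) v) (trans (cong (app (pow g d)) (app-pow-multiple g d e k)) e)

app-pow-∣ : ∀ {N} (g : Perm N) {d j v} → app (pow g d) v ≡ v → d ∣ j → app (pow g j) v ≡ v
app-pow-∣ g {d} e (divides k refl) = app-pow-multiple g d e k

-- Division with remainder: g^(j mod d) fixes v as well, and the minimality of d leaves only the
-- remainder 0.
cycle⇒∣ : ∀ {N} (g : Perm N) {d v} → 0 < d → CycleOfLength g v d → ∀ j → app (pow g j) v ≡ v → d ∣ j
cycle⇒∣ g {d} {v} 0<d (closes , minimal) j fixed = Div.m%n≡0⇒n∣m j d (zero-remainder (j DivMod.% d) refl)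
  where
  instance
    d≢0 : NonZero d
    d≢0 = ℕ.>-nonZero 0<d
  remainder-fixes : app (pow g (j DivMod.% d)) v ≡ v
  remainder-fixes = begin
    app (pow g (j DivMod.% d)) v
      ≡⟨ cong (app (pow g (j DivMod.% d))) (app-pow-multiple g d closes (j DivMod./ d)) ⟨
    app (pow g (j DivMod.% d)) (app (pow g ((j DivMod./ d) ℕ.* d)) v)
      ≡⟨ app-pow-+ g (j DivMod.% d) ((j DivMod./ d) ℕ.* d) v ⟨
    app (pow g (j DivMod.% d ℕ.+ (j DivMod./ d) ℕ.* d)) v
      ≡⟨ cong (λ i → app (pow g i) v) (DivMod.m≡m%n+[m/n]*n j d) ⟨
    app (pow g j) v
      ≡⟨ fixed ⟩
    v ∎
    where open ≡-Reasoning
  zero-remainder : ∀ r → r ≡ j DivMod.% d → j DivMod.% d ≡ 0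
  zero-remainder zero    e = sym e
  zero-remainder (suc r) e = ⊥-elim (minimal (j DivMod.% d) (subst (0 <_) e (s≤s z≤n)) (DivMod.m%n<n j d) remainder-fixes)

module _ {d : ℕ} (0<d : 0 < d) (i : ℕ) where

  ∣order* : d ∣ order d i ℕ.* i
  ∣order* with GCD.gcd[m,n]∣m i d
  ... | divides a i≡ = divides a (begin
    order d i ℕ.* i                   ≡⟨ cong (order d i ℕ.*_) i≡ ⟩
    order d i ℕ.* (a ℕ.* gcd i d)     ≡⟨ ℕP.*-assoc (order d i) a _ ⟨
    order d i ℕ.* a ℕ.* gcd i d       ≡⟨ cong (ℕ._* gcd i d) (ℕP.*-comm (order d i) a) ⟩
    a ℕ.* order d i ℕ.* gcd i d       ≡⟨ ℕP.*-assoc a (order d i) _ ⟩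
    a ℕ.* (order d i ℕ.* gcd i d)     ≡⟨ cong (a ℕ.*_) (order-* 0<d i) ⟩
    a ℕ.* d                           ∎)
    where open ≡-Reasoning

  -- With γ = gcd(i, d), cancelling γ from d ∣ k i gives d/γ ∣ (i/γ) k, and d/γ is coprime to i/γ.
  ∣*⇒order∣ : ∀ k → d ∣ k ℕ.* i → order d i ∣ k
  ∣*⇒order∣ k d∣ki with GCD.gcd[m,n]∣m i d
  ... | divides a i≡ = Coprime.coprime-divisor {n = a} (Coprime.gcd≡1⇒coprime gcd≡1) o∣ak
    where
    γ = gcd i d
    o = order d i
    instance
      γ≢0 : NonZero γ
      γ≢0 = ℕ.>-nonZero (0<-gcd 0<d i)
    gcd≡1 : gcd o a ≡ 1
    gcd≡1 = ℕP.*-cancelˡ-≡ (gcd o a) 1 γ (begin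
      γ ℕ.* gcd o a             ≡⟨ GCD.c*gcd[m,n]≡gcd[cm,cn] γ o a ⟩
      gcd (γ ℕ.* o) (γ ℕ.* a)   ≡⟨ cong₂ gcd (trans (ℕP.*-comm γ o) (order-* 0<d i)) (trans (ℕP.*-comm γ a) (sym i≡)) ⟩
      gcd d i                   ≡⟨ GCD.gcd-comm d i ⟩
      γ                         ≡⟨ ℕP.*-identityʳ γ ⟨
      γ ℕ.* 1                   ∎)
      where open ≡-Reasoning
    o∣ak : o ∣ a ℕ.* k
    o∣ak = Div.*-cancelʳ-∣ γ (subst₂ _∣_ (sym (order-* 0<d i))
      (trans (cong (k ℕ.*_) i≡) (trans (sym (ℕP.*-assoc k a γ)) (cong (ℕ._* γ) (ℕP.*-comm k a)))) d∣ki)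

  0<-order : 0 < order d i
  0<-order = ∣⇒0< 0<d (order∣ 0<d i)

  -- The k-th power of g^i fixes v exactly when d ∣ k i, that is, when `order d i` ∣ k.
  cycle-pow : ∀ {N} (g : Perm N) {v} → CycleOfLength g v d → CycleOfLength (pow g i) v (order d i)
  cycle-pow g {v} cyc@(closes , _) =
    trans (cong (λ h → app h v) (pow-* g i (order d i))) (app-pow-∣ g closes ∣order*) ,
    λ k 0<k k<o fixed → ℕP.<⇒≱ k<o (∣⇒≤′ 0<k (∣*⇒order∣ k
      (cycle⇒∣ g 0<d cyc (k ℕ.* i) (trans (cong (λ h → app h v) (sym (pow-* g i k))) fixed))))

fixed-cycle : ∀ {N} {g : Perm N} {v} → app g v ≡ v → ∀ i → CycleOfLength (pow g i) v 1
fixed-cycle {g = g} {v} e i = trans (cong (λ h → app h v) (pow-* g i 1)) (app-pow-∣ g g¹v≡v (Div.1∣ (1 ℕ.* i))) ,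
  λ { (suc k) _ (s≤s ()) }
  where
  g¹v≡v : app (pow g 1) v ≡ v
  g¹v≡v = trans (cong (λ h → app h v) (∘P-identityʳ g)) e

oneTo-sorted : ∀ n → AllPairs.AllPairs _<_ (oneTo n)
oneTo-sorted n = AllPairsP.map⁺ (AllPairsP.applyUpTo⁺₁ id n (λ i<j _ → s≤s i<j))

-- `cycleLen` takes the head of the periods listed in `oneTo N`. The bound e ≤ N keeps that list
-- nonempty, which excludes the default 0; since the list increases, a head other than e would be a
-- period smaller than e.
cycleLen-cycle : ∀ {N} (h : Perm N) {v e} → 0 < e → e ≤ N → CycleOfLength h v e → cycleLen h v ≡ e
cycleLen-cycle {N} h {v} {e} 0<e e≤N (closes , minimal)
  with L.filterᵇ (λ k → app (pow h k) v =ᶠ v) (oneTo N) in eq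
... | [] = ⊥-elim (¬Any[] (subst (e ∈_) eq (∈-filterᵇ⁺ (∈-oneTo⁺ 0<e e≤N) (=ᶠ⁺ closes))))
... | k ∷ ks = first (subst (e ∈_) eq (∈-filterᵇ⁺ (∈-oneTo⁺ 0<e e≤N) (=ᶠ⁺ closes)))
                     (subst (AllPairs.AllPairs _<_) eq (AllPairsP.filter⁺ _ (oneTo-sorted N)))
                     (∈-filterᵇ⁻ {xs = oneTo N} (subst (k ∈_) (sym eq) (here refl)))
  where
  first : e ∈ k ∷ ks → AllPairs.AllPairs _<_ (k ∷ ks) → k ∈ oneTo N × (app (pow h k) v =ᶠ v) ≡ true → k ≡ e
  first (here e≡k)   _           _           = sym e≡k
  first (there e∈ks) (k< ∷ _) (k∈ , fixed) =
    ⊥-elim (minimal k (proj₁ (∈-oneTo⁻ k∈)) (All.lookup k< e∈ks) (=ᶠ⁻ fixed))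

-- Cycle types obtained from cycle lengths

count-constant : {A : Set} {p : A → Bool} {b : Bool} (xs : List A) → (∀ {v} → v ∈ xs → p v ≡ b) →
  count p xs ≡ (if b then length xs else 0)
count-constant {b = true}  []       h = refl
count-constant {b = false} []       h = refl
count-constant {p = p} {b} (x ∷ xs) h with p x | h (here refl)
count-constant {b = true}  (x ∷ xs) h | true  | refl = cong suc (count-constant xs (h ∘ there))
count-constant {b = false} (x ∷ xs) h | false | refl = count-constant xs (h ∘ there)

-- `pred` separates the exceptional entry from the others, the form in which the fixed vertex and
-- the n remaining ones enter `monoK oneFixed`.
count-exception : {A : Set} {p : A → Bool} {b : Bool} {x : A} {xs : List A} → Unique xs → x ∈ xs →
  (∀ {v} → v ≢ x → p v ≡ b) → count p xs ≡ (if p x then 1 else 0) ℕ.+ (if b then ℕ.pred (length xs) else 0)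
count-exception {p = p} {xs = y ∷ ys} (y≢ ∷ u) (here refl) h
  with p y | count-constant {p = p} ys (λ v∈ → h (λ v≡y → All.lookup y≢ v∈ (sym v≡y)))
... | true  | e = cong suc e
... | false | e = e
count-exception {p = p} {b} {x} {xs = y ∷ ys} (y≢ ∷ u) (there x∈) h
  with p y | h (All.lookup y≢ x∈)
count-exception {p = p} {true}  {x} {y ∷ ys} (y≢ ∷ u) (there x∈) h | true  | refl =
  trans (cong suc (count-exception u x∈ h))
        (trans (sym (ℕP.+-suc _ (ℕ.pred (length ys))))
               -- Here x lies in the tail, so the tail is not empty and `suc` undoes `pred` on its
               -- length.
               (cong ((if p x then 1 else 0) ℕ.+_) (ℕP.suc-pred (length ys) ⦃ ℕ.>-nonZero (∈-length x∈) ⦄)))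
count-exception {p = p} {false} {x} {y ∷ ys} (y≢ ∷ u) (there x∈) h | false | refl = count-exception u x∈ h

length-allFin : ∀ N → length (allFin N) ≡ N
length-allFin N = LP.length-tabulate id

-- Passes from vertices to cycles: the left side divides the number of vertices on cycles of length
-- `suc s`, the right side is the exponent in `monoK`. If the lengths differ, 0 is divided and stays
-- 0.
if-div : ∀ n e s → (if e == suc s then n else 0) ℕ./ suc s ≡ (if suc s == e then n div e else 0)
if-div n e s with e ℕ.≟ suc s
... | yes refl rewrite ==⁺ {suc s} refl = refl
... | no e≢    rewrite ==-≢ {suc s} {e} (e≢ ∘ sym) = DivMod.0/n≡0 (suc s)

cycleType-semiregular : ∀ {n e} (h : Perm n) → (∀ v → cycleLen h v ≡ e) → cycleType h ≡ monoK semiregular n e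
cycleType-semiregular {n} {e} h len = VP.tabulate-cong (λ i → trans
  (cong (ℕ._/ suc (toℕ i)) (trans
    (count-constant {b = e == suc (toℕ i)} (allFin n) (λ {v} _ → cong (_== suc (toℕ i)) (len v)))
    (cong (λ N → if e == suc (toℕ i) then N else 0) (length-allFin n))))
  (if-div n e (toℕ i)))

cycleType-oneFixed : ∀ {n e} (h : Perm (suc n)) (x : Fin (suc n)) → cycleLen h x ≡ 1 →
  (∀ v → v ≢ x → cycleLen h v ≡ e) → cycleType h ≡ monoK oneFixed n e
cycleType-oneFixed {n} {e} h x len-x len = VP.tabulate-cong (λ i → trans
  (cong (ℕ._/ suc (toℕ i)) (trans
    (count-exception {b = e == suc (toℕ i)} (Unique.allFin⁺ (suc n)) (∈-allFin x)
      (λ {v} v≢x → cong (_== suc (toℕ i)) (len v v≢x)))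
    (cong₂ (λ l N → (if l == suc (toℕ i) then 1 else 0) ℕ.+ (if e == suc (toℕ i) then ℕ.pred N else 0))
      len-x (length-allFin (suc n)))))
  (divide (toℕ i)))
  where
  divide : ∀ s → ((if 1 == suc s then 1 else 0) ℕ.+ (if e == suc s then n else 0)) ℕ./ suc s
    ≡ (if s == 0 then 1 else 0) ℕ.+ (if suc s == e then n div e else 0)
  -- Among the 1-cycles the fixed vertex is joined by the n others if e = 1; division by 1 keeps the
  -- two summands apart. For longer cycles the first summand is 0 by computation.
  divide zero    = trans (DivMod.n/1≡n (suc m)) (cong suc (trans (sym (DivMod.n/1≡n m)) (if-div n e 0)))
    where
    m = if e == 1 then n else 0
  divide (suc s) = if-div n e (suc s)

0<-div : ∀ {n e} → 0 < n → e ∣ n → 0 < n div e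
0<-div {e = e} 0<n (divides q refl) =
  subst (0 <_) (sym (*-div q (0<-*ʳ q 0<n))) (0<-*ˡ q 0<n)

≤-verts : ∀ κ {n} → n ≤ verts κ n
≤-verts semiregular = ℕP.≤-refl
≤-verts oneFixed    = ℕP.n≤1+n _

-- The exponents that `monoK κ n k` has whatever k is. Once they are split off, comparing two
-- monomials concerns only the part depending on k.
fixedPoints : ∀ κ {n} → Fin (verts κ n) → ℕ
fixedPoints semiregular i = 0
fixedPoints oneFixed    i = if toℕ i == 0 then 1 else 0

lookup-monoK : ∀ κ n k i →
  lookup (monoK κ n k) i ≡ fixedPoints κ i ℕ.+ (if suc (toℕ i) == k then n div k else 0)
lookup-monoK semiregular n k i = VP.lookup∘tabulate (λ i → if suc (toℕ i) == k then n div k else 0) i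
lookup-monoK oneFixed    n k i = VP.lookup∘tabulate
  (λ i → (if toℕ i == 0 then 1 else 0) ℕ.+ (if suc (toℕ i) == k then n div k else 0)) i

-- The exponents of s_e are compared: beyond the common `fixedPoints`, the exponent is n/e > 0 on
-- one side and 0 on the other if e and k differ.
monoK-injective : ∀ κ {n e k} → 0 < n → e ∣ n → k ∣ n → monoK κ n e ≡ monoK κ n k → e ≡ k
monoK-injective κ {n} {zero}  0<n e∣n k∣n eq = ⊥-elim (ℕP.<-irrefl refl (∣⇒0< 0<n e∣n))
monoK-injective κ {n} {suc e} {k} 0<n e∣n k∣n eq with suc e ℕ.≟ k
... | yes e≡k = e≡k
... | no  e≢k = ⊥-elim (ℕP.<⇒≢ (0<-div 0<n e∣n) (sym zero-exponent))
  where
  -- Exponents are stored from s_1 on, so the one of the variable with index `suc e` sits at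
  -- position `e`.
  at : Fin (verts κ n)
  at = Fin.fromℕ< {e} (ℕP.<-≤-trans (∣⇒≤′ 0<n e∣n) (≤-verts κ))
  toℕ-at : toℕ at ≡ e
  toℕ-at = FinP.toℕ-fromℕ< _
  coefficient : ℕ → ℕ
  coefficient j = if suc (toℕ at) == j then n div j else 0
  coefficient-e : coefficient (suc e) ≡ n div suc e
  coefficient-e rewrite toℕ-at | ==⁺ {suc e} refl = refl
  coefficient-k : coefficient k ≡ 0
  coefficient-k rewrite toℕ-at | ==-≢ e≢k = refl
  zero-exponent : n div suc e ≡ 0
  zero-exponent = trans (sym coefficient-e) (trans
    (ℕP.+-cancelˡ-≡ (fixedPoints κ at) (coefficient (suc e)) (coefficient k)
      (trans (sym (lookup-monoK κ n (suc e) at)) (trans (cong (λ m → lookup m at) eq) (lookup-monoK κ n k at))))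
    coefficient-k)

-- The common ground of the two kinds of generator: after `generatorShape⇒cyclicShape` no argument
-- distinguishes them.
record CyclicShape (κ : Kind) (n d : ℕ) (g : Perm (verts κ n)) : Set where
  field
    basepoint       : Fin (verts κ n)
    basepoint-cycle : CycleOfLength g basepoint d
    pow-order       : pow g d ≡ idP
    cycleType-pow   : ∀ i → cycleType (pow g i) ≡ monoK κ n (order d i)

generatorShape⇒cyclicShape : ∀ κ {n d} {g : Perm (verts κ n)} → 0 < n → d ∣ n → GeneratorShape κ n d g → CyclicShape κ n d g
generatorShape⇒cyclicShape semiregular {n} {d} {g} 0<n d∣n shape = record
  { basepoint       = Fin.fromℕ< 0<n
  ; basepoint-cycle = shape _
  ; pow-order       = vec-ext (λ v → trans (proj₁ (shape v)) (sym (app-idP v)))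
  ; cycleType-pow   = λ i → cycleType-semiregular (pow g i) (λ v → cycleLen-cycle (pow g i) (0<-order 0<d i)
      (ℕP.≤-trans (∣⇒≤′ 0<d (order∣ 0<d i)) (∣⇒≤′ 0<n d∣n)) (cycle-pow 0<d i g (shape v)))
  }
  where
  0<d = ∣⇒0< 0<n d∣n
generatorShape⇒cyclicShape oneFixed {n} {d} {g} 0<n d∣n (x , fixed , shape) = record
  { basepoint       = proj₁ (other x)
  ; basepoint-cycle = shape _ (proj₂ (other x))
  ; pow-order       = vec-ext closes
  ; cycleType-pow   = λ i → cycleType-oneFixed (pow g i) x
      (cycleLen-cycle (pow g i) (s≤s z≤n) (s≤s z≤n) (fixed-cycle fixed i))
      (λ v v≢x → cycleLen-cycle (pow g i) (0<-order 0<d i)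
        (ℕP.≤-trans (∣⇒≤′ 0<d (order∣ 0<d i)) (ℕP.≤-trans (∣⇒≤′ 0<n d∣n) (ℕP.n≤1+n n)))
        (cycle-pow 0<d i g (shape v v≢x)))
  }
  where
  0<d = ∣⇒0< 0<n d∣n
  -- As n > 0, there is a vertex besides the fixed one; its cycle has length exactly d, so it can
  -- serve as basepoint.
  other : ∀ x → ∃ λ v → v ≢ x
  other Fin.zero    = Fin.suc (Fin.fromℕ< 0<n) , λ ()
  other (Fin.suc _) = Fin.zero , λ ()
  closes : ∀ v → app (pow g d) v ≡ app idP v
  closes v with v Fin.≟ x
  ... | yes refl = trans (app-pow-∣ g {1} (trans (cong (λ h → app h v) (∘P-identityʳ g)) fixed) (Div.1∣ d)) (sym (app-idP v))
  ... | no v≢x   = trans (proj₁ (shape v v≢x)) (sym (app-idP v))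

-- The powers of a generator

module _ {κ : Kind} {n d : ℕ} {g : Perm (verts κ n)} (0<d : 0 < d) (shape : CyclicShape κ n d g) where

  open CyclicShape shape

  pow-mod : ∀ i → pow g i ≡ pow g (DivMod._%_ i d ⦃ ℕ.>-nonZero 0<d ⦄)
  pow-mod i = begin
    pow g i                                        ≡⟨ cong (pow g) (DivMod.m≡m%n+[m/n]*n i d) ⟩
    pow g (i DivMod.% d ℕ.+ (i DivMod./ d) ℕ.* d)  ≡⟨ pow-+ g (i DivMod.% d) _ ⟩
    pow g (i DivMod.% d) ∘P pow g ((i DivMod./ d) ℕ.* d)
      ≡⟨ cong (pow g (i DivMod.% d) ∘P_) (trans (sym (pow-* g d (i DivMod./ d))) (trans (cong (λ h → pow h (i DivMod./ d)) pow-order) (pow-idP (i DivMod./ d)))) ⟩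
    pow g (i DivMod.% d) ∘P idP                    ≡⟨ ∘P-identityʳ _ ⟩
    pow g (i DivMod.% d)                           ∎
    where
    open ≡-Reasoning
    instance
      d≢0 : NonZero d
      d≢0 = ℕ.>-nonZero 0<d
    pow-idP : ∀ {N} k → pow (idP {N}) k ≡ idP
    pow-idP zero    = refl
    pow-idP (suc k) = trans (∘P-identityˡ _) (pow-idP k)

  pow-oneTo : ∀ i → ∃ λ j → j ∈ oneTo d × pow g j ≡ pow g i
  pow-oneTo i = go (DivMod._%_ i d ⦃ ℕ.>-nonZero 0<d ⦄) (DivMod.m%n<n i d ⦃ ℕ.>-nonZero 0<d ⦄) (pow-mod i)
    where
    go : ∀ r → r < d → pow g i ≡ pow g r → ∃ λ j → j ∈ oneTo d × pow g j ≡ pow g i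
    -- Exponents run from 1 to d, so the remainder 0 is represented by d.
    go zero    _   e = d , ∈-oneTo⁺ 0<d ℕP.≤-refl , trans pow-order (sym e)
    go (suc r) r<d e = suc r , ∈-oneTo⁺ (s≤s z≤n) (ℕP.<⇒≤ r<d) , sym e

  -- Cancelling g^i, whose inverse is g^(d - i), from g^i = g^j shows that g^(j - i) fixes the
  -- basepoint. But 0 < j - i < d, because i is positive and j ≤ d.
  pow-injective-< : ∀ {i j} → 0 < i → i < j → j ≤ d → pow g i ≢ pow g j
  pow-injective-< {i} {j} 0<i i<j j≤d e = proj₂ basepoint-cycle (j ℕ.∸ i) (ℕP.m<n⇒0<n∸m i<j)
    (ℕP.<-≤-trans (ℕP.∸-monoʳ-< 0<i (ℕP.<⇒≤ i<j)) j≤d)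
    (cancel (begin
      app (pow g (d ℕ.∸ i)) (app (pow g i) (app (pow g (j ℕ.∸ i)) v))
        ≡⟨ cong (app (pow g (d ℕ.∸ i))) (trans (sym (app-pow-+ g i (j ℕ.∸ i) v)) (cong (λ t → app (pow g t) v) (ℕP.m+[n∸m]≡n (ℕP.<⇒≤ i<j)))) ⟩
      app (pow g (d ℕ.∸ i)) (app (pow g j) v)
        ≡⟨ cong (λ h → app (pow g (d ℕ.∸ i)) (app h v)) e ⟨
      app (pow g (d ℕ.∸ i)) (app (pow g i) v) ∎))
    where
    open ≡-Reasoning
    v = basepoint
    undo : ∀ w → app (pow g (d ℕ.∸ i)) (app (pow g i) w) ≡ w
    undo w = trans (sym (app-pow-+ g (d ℕ.∸ i) i w))
      (trans (cong (λ t → app (pow g t) w) (ℕP.m∸n+n≡m (ℕP.≤-trans (ℕP.<⇒≤ i<j) j≤d)))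
             (trans (cong (λ h → app h w) pow-order) (app-idP w)))
    cancel : ∀ {x y} → app (pow g (d ℕ.∸ i)) (app (pow g i) x) ≡ app (pow g (d ℕ.∸ i)) (app (pow g i) y) → x ≡ y
    cancel {x} {y} eq = trans (sym (undo x)) (trans eq (undo y))

  pow-injective : ∀ {i j} → i ∈ oneTo d → j ∈ oneTo d → pow g i ≡ pow g j → i ≡ j
  pow-injective {i} {j} i∈ j∈ e with ℕP.<-cmp i j | ∈-oneTo⁻ i∈ | ∈-oneTo⁻ j∈
  ... | tri< i<j _ _ | 0<i , _ | _ , j≤d = ⊥-elim (pow-injective-< 0<i i<j j≤d e)
  ... | tri≈ _ i≡j _ | _       | _       = i≡j
  ... | tri> _ _ j<i | _ , i≤d | 0<j , _ = ⊥-elim (pow-injective-< 0<j j<i i≤d (sym e))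

  powers↭ : {H : List (Perm (verts κ n))} → Unique H → (∀ i → pow g i ∈ H) →
    (∀ {h} → h ∈ H → ∃ λ i → pow g i ≡ h) → map (pow g) (oneTo d) ↭ H
  powers↭ uH into onto = bijection⇒↭ (pow g) (oneTo-unique d) uH (λ {i} _ → into i) pow-injective
    (λ h∈ → let i , e = onto h∈ ; j , j∈ , e′ = pow-oneTo i in j , j∈ , trans e′ e)

-- Cycle-index polynomials

module ℚSolver = Solver.+-*-Solver

=m⁺ : ∀ {N} {a b : Mono N} → a ≡ b → (a =m b) ≡ true
=m⁺ {a = a} {b} = ⌊⌋⁺ (VP.≡-dec ℕ._≟_ a b)

=m-≢ : ∀ {N} {a b : Mono N} → a ≢ b → (a =m b) ≡ false
=m-≢ {a = a} {b} = ⌊⌋-no (VP.≡-dec ℕ._≟_ a b)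

=P⁺ : ∀ {N} {g h : Perm N} → g ≡ h → (g =P h) ≡ true
=P⁺ {g = g} {h} = ⌊⌋⁺ (VP.≡-dec Fin._≟_ g h)

monomial-coefficient : ∀ {N} (a : Mono N) c m → [ a ]ₘ c m ≡ fromℕ c * ⟦ a =m m ⟧
monomial-coefficient a c m = trans (⟦⟧*-if (a =m m) (fromℕ c)) (ℚP.*-comm ⟦ a =m m ⟧ (fromℕ c))

0<-φ : ∀ {k} → 0 < k → 0 < φ k
0<-φ {k} 0<k = ∈-length {xs = filterᵇ (λ j → gcd j k == 1) (oneTo k)}
  (∈-filterᵇ⁺ {x = 1} (∈-oneTo⁺ (s≤s z≤n) 0<k) (==⁺ (GCD.gcd-zeroˡ k)))

-- d times the cycle index of a cyclic group of order d
unnormalised : (κ : Kind) (n d : ℕ) → Poly (verts κ n)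
unnormalised κ n d m = ∑ (divisorsOf d) (λ k → [ monoK κ n k ]ₘ (φ k) m)

-- Different divisors of n give different monomials, so of the sum over j ∣ d only the term j = k
-- can reach this coefficient, and it is present exactly when k ∣ d.
unnormalised-coefficient : ∀ κ {n d k} → 0 < n → d ∣ n → k ∣ n →
  unnormalised κ n d (monoK κ n k) ≡ ⟦ ⌊ k ∣? d ⌋ ⟧ * fromℕ (φ k)
unnormalised-coefficient κ {n} {d} {k} 0<n d∣n k∣n = go (k ∣? d)
  where
  term : ℕ → ℚ
  term j = [ monoK κ n j ]ₘ (φ j) (monoK κ n k)
  term-≢ : ∀ {j} → j ∣ d → j ≢ k → term j ≡ 0ℚ
  term-≢ {j} j∣d j≢k = trans (monomial-coefficient (monoK κ n j) (φ j) (monoK κ n k))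
    (trans (cong (λ b → fromℕ (φ j) * ⟦ b ⟧) (=m-≢ {a = monoK κ n j} {monoK κ n k}
             (j≢k ∘ monoK-injective κ 0<n (Div.∣-trans j∣d d∣n) k∣n)))
           (ℚP.*-zeroʳ (fromℕ (φ j))))
  term-k : term k ≡ 1ℚ * fromℕ (φ k)
  term-k = trans (monomial-coefficient (monoK κ n k) (φ k) (monoK κ n k))
    (trans (cong (λ b → fromℕ (φ k) * ⟦ b ⟧) (=m⁺ {a = monoK κ n k} refl))
           (ℚP.*-comm (fromℕ (φ k)) 1ℚ))
  go : (k∣d? : Dec (k ∣ d)) → ∑ (divisorsOf d) term ≡ ⟦ ⌊ k∣d? ⌋ ⟧ * fromℕ (φ k)
  go (yes k∣d) = trans
    (∑-single term (divisorsOf-unique d) (∈-divisorsOf⁺ (∣⇒0< 0<n d∣n) k∣d)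
      (λ {j} j∈ → term-≢ {j} (∈-divisorsOf⁻ j∈)))
    term-k
  go (no k∤d) = trans
    (∑-0 (divisorsOf d) (λ {j} j∈ → term-≢ {j} (∈-divisorsOf⁻ j∈)
      (λ j≡k → k∤d (subst (_∣ d) j≡k (∈-divisorsOf⁻ j∈)))))
    (sym (ℚP.*-zeroˡ (fromℕ (φ k))))

coefficient-inversion : ∀ κ {n} {P : Poly (verts κ n)} {c : ℕ → ℚ} → 0 < n → Decomposes κ n P c → ∀ {d} → d ∣ n →
  c d ≡ fromℕ d * ∑ (multiplesIn d n) (λ k → P (monoK κ n k) * inv (φ k) * fromℤ (μ (k div d)))
coefficient-inversion κ {n} {P} {c} 0<n dec {d} d∣n = sym (begin
  fromℕ d * ∑ (multiplesIn d n) (λ k → P (monoK κ n k) * inv (φ k) * fromℤ (μ (k div d)))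
    ≡⟨ cong (fromℕ d *_) (∑-cong (multiplesIn d n) (λ {k} k∈ →
         cong (_* fromℤ (μ (k div d))) (scaled (proj₂ (∈-multiplesIn⁻ {n = n} k∈))))) ⟩
  fromℕ d * ∑ (multiplesIn d n) (λ k → ∑ (divisorsOf n) (λ e → ⟦ ⌊ k ∣? e ⌋ ⟧ * (c e * inv e)) * fromℤ (μ (k div d)))
    ≡⟨ cong (fromℕ d *_) (möbius-inversion (λ e → c e * inv e) 0<n d∣n) ⟩
  fromℕ d * (c d * inv d)
    ≡⟨ *-swapˡ (fromℕ d) (c d) (inv d) ⟩
  c d * (fromℕ d * inv d)
    ≡⟨ cong (c d *_) (inv-inverseʳ (∣⇒0< 0<n d∣n)) ⟩
  c d * 1ℚ
    ≡⟨ ℚP.*-identityʳ (c d) ⟩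
  c d ∎)
  where
  open ≡-Reasoning
  rearrange : ∀ c v b f i → i * (c * (v * (b * f))) ≡ (b * (c * v)) * (i * f)
  rearrange = ℚSolver.solve 5 (λ c v b f i → i :* (c :* (v :* (b :* f))) := (b :* (c :* v)) :* (i :* f)) refl
    where open ℚSolver using (_:*_; _:=_)
  -- Dividing by φ(k) > 0 removes the factor common to all e. What remains is a plain sum over the
  -- multiples of k, to which the inversion applies with c_e / e in place of c_e.
  scaled : ∀ {k} → k ∣ n → P (monoK κ n k) * inv (φ k) ≡ ∑ (divisorsOf n) (λ e → ⟦ ⌊ k ∣? e ⌋ ⟧ * (c e * inv e))
  scaled {k} k∣n = begin
    P (monoK κ n k) * inv (φ k)
      ≡⟨ cong (_* inv (φ k)) (dec (monoK κ n k)) ⟩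
    ∑ (divisorsOf n) (λ e → c e * cycIdx κ n e (monoK κ n k)) * inv (φ k)
      ≡⟨ ℚP.*-comm (∑ (divisorsOf n) (λ e → c e * cycIdx κ n e (monoK κ n k))) (inv (φ k)) ⟩
    inv (φ k) * ∑ (divisorsOf n) (λ e → c e * cycIdx κ n e (monoK κ n k))
      ≡⟨ ∑-*ˡ (divisorsOf n) (inv (φ k)) (λ e → c e * cycIdx κ n e (monoK κ n k)) ⟩
    ∑ (divisorsOf n) (λ e → inv (φ k) * (c e * cycIdx κ n e (monoK κ n k)))
      ≡⟨ ∑-cong (divisorsOf n) (λ {e} e∈ → trans
           (cong (λ t → inv (φ k) * (c e * (inv e * t))) (unnormalised-coefficient κ 0<n (∈-divisorsOf⁻ e∈) k∣n))
           (trans (rearrange (c e) (inv e) ⟦ ⌊ k ∣? e ⌋ ⟧ (fromℕ (φ k)) (inv (φ k)))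
             (trans (cong ((⟦ ⌊ k ∣? e ⌋ ⟧ * (c e * inv e)) *_) (inv-inverseˡ (0<-φ (∣⇒0< 0<n k∣n))))
               (ℚP.*-identityʳ (⟦ ⌊ k ∣? e ⌋ ⟧ * (c e * inv e)))))) ⟩
    ∑ (divisorsOf n) (λ e → ⟦ ⌊ k ∣? e ⌋ ⟧ * (c e * inv e)) ∎

-- The imbedding sum of a graph with cyclic map-automorphism groups

-- Meant for g = |Γ|, I = i_d, D = d and M the number of maps with stabilizer of order d: from |Γ|
-- i_d = d M it follows that M/|Γ| = i_d/d. The inverses are variables, so that the ring solver can
-- move them.
quotient-transfer : ∀ {g g⁻¹ I D D⁻¹ M} f → g⁻¹ * g ≡ 1ℚ → D⁻¹ * D ≡ 1ℚ → g * I ≡ D * M →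
  g⁻¹ * (M * f) ≡ I * (D⁻¹ * f)
quotient-transfer {g} {g⁻¹} {I} {D} {D⁻¹} {M} f g-inv D-inv gI≡DM = begin
  g⁻¹ * (M * f)                   ≡⟨ ℚP.*-identityˡ (g⁻¹ * (M * f)) ⟨
  1ℚ * (g⁻¹ * (M * f))            ≡⟨ cong (_* (g⁻¹ * (M * f))) D-inv ⟨
  (D⁻¹ * D) * (g⁻¹ * (M * f))     ≡⟨ ℚSolver.solve 5 (λ D D⁻¹ M f g⁻¹ →
                                       (D⁻¹ :* D) :* (g⁻¹ :* (M :* f)) := g⁻¹ :* ((D :* M) :* (D⁻¹ :* f))) refl D D⁻¹ M f g⁻¹ ⟩
  g⁻¹ * ((D * M) * (D⁻¹ * f))     ≡⟨ cong (λ t → g⁻¹ * (t * (D⁻¹ * f))) gI≡DM ⟨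
  g⁻¹ * ((g * I) * (D⁻¹ * f))     ≡⟨ ℚSolver.solve 5 (λ g g⁻¹ I D⁻¹ f →
                                       g⁻¹ :* ((g :* I) :* (D⁻¹ :* f)) := (g⁻¹ :* g) :* (I :* (D⁻¹ :* f))) refl g g⁻¹ I D⁻¹ f ⟩
  (g⁻¹ * g) * (I * (D⁻¹ * f))     ≡⟨ cong (_* (I * (D⁻¹ * f))) g-inv ⟩
  1ℚ * (I * (D⁻¹ * f))            ≡⟨ ℚP.*-identityˡ (I * (D⁻¹ * f)) ⟩
  I * (D⁻¹ * f)                   ∎
  where
  open ≡-Reasoning
  open ℚSolver using (_:*_; _:=_)

module _ (κ : Kind) {n : ℕ} (0<n : 0 < n) (G : Graph (verts κ n))
         (hyp : ∀ ρ → isMap G ρ ≡ true → CyclicHyp κ n G ρ) where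

  private
    N = verts κ n
    Γ = Aut G
    𝓜 = allMaps G

    |stab| : RotSys N → ℕ
    |stab| ρ = length (stab G ρ)

  -- The hypothesis places the stabilizer within the powers of its generator; this is the opposite
  -- inclusion.
  pow-∈-stab : ∀ {g ρ} → g ∈ stab G ρ → ∀ i → pow g i ∈ stab G ρ
  pow-∈-stab {g} {ρ} g∈ zero    = ∈stab⁺ G {idP} {ρ} (Aut-id G) (act-idP ρ)
  pow-∈-stab {g} {ρ} g∈ (suc i) = ∈stab⁺ G {g ∘P pow g i} {ρ} (Aut-∘ G (proj₁ g-stab) (proj₁ gⁱ-stab))
    (trans (act-∘P (Aut-permutation G (proj₁ g-stab)) (Aut-permutation G (proj₁ gⁱ-stab)) ρ)
           (trans (cong (act g) (proj₂ gⁱ-stab)) (proj₂ g-stab)))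
    where
    g-stab = ∈stab⁻ G {g} {ρ} g∈
    gⁱ-stab = ∈stab⁻ G {pow g i} {ρ} (pow-∈-stab {g} {ρ} g∈ i)

  -- Here d is the cycle length given by the hypothesis. That it is the order of the stabilizer is
  -- derived in `order≡`, by listing the stabilizer as g^1, ..., g^d.
  record CyclicStabilizer (ρ : RotSys N) : Set where
    field
      {d}       : ℕ
      d∣n       : d ∣ n
      {g}       : Perm N
      g∈        : g ∈ stab G ρ
      shape     : CyclicShape κ n d g
      generates : ∀ {h} → h ∈ stab G ρ → ∃ λ i → pow g i ≡ h

    0<d : 0 < d
    0<d = ∣⇒0< 0<n d∣n

    powers : map (pow g) (oneTo d) ↭ stab G ρ
    powers = powers↭ {κ} 0<d shape (stab-unique G ρ) (pow-∈-stab {g} {ρ} g∈) generates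

    order≡ : |stab| ρ ≡ d
    order≡ = trans (sym (↭-length powers)) (trans (LP.length-map (pow g) (oneTo d))
      (trans (LP.length-map suc (upTo d)) (LP.length-upTo d)))

  cyclicStabilizer : ∀ {ρ} → ρ ∈ 𝓜 → CyclicStabilizer ρ
  cyclicStabilizer {ρ} ρ∈ = convert (hyp ρ (∈allMaps⁻ G {ρ} ρ∈))
    where
    convert : CyclicHyp κ n G ρ → CyclicStabilizer ρ
    convert (d , d∣n , g , g∈ , gs , gen) = record
      { d∣n = d∣n ; g∈ = g∈ ; shape = generatorShape⇒cyclicShape κ 0<n d∣n gs ; generates = λ {h} → gen h }

  |stab|∣n : ∀ {ρ} → ρ ∈ 𝓜 → |stab| ρ ∣ n
  |stab|∣n {ρ} ρ∈ = subst (_∣ n) (sym order≡) d∣n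
    where open CyclicStabilizer (cyclicStabilizer {ρ} ρ∈)

  stab-cycleTypes : ∀ m {ρ} → ρ ∈ 𝓜 →
    ∑ (stab G ρ) (λ h → ⟦ cycleType h =m m ⟧) ≡ unnormalised κ n (|stab| ρ) m
  stab-cycleTypes m {ρ} ρ∈ =
    trans (sym (∑-↭ (λ h → ⟦ cycleType h =m m ⟧) powers))
    (trans (∑-map (pow g) (oneTo d) (λ h → ⟦ cycleType h =m m ⟧))
    (trans (∑-cong (oneTo d) (λ {i} _ → cong (λ t → ⟦ t =m m ⟧) (CyclicShape.cycleType-pow shape i)))
    (trans (∑-by-order 0<d (λ k → ⟦ monoK κ n k =m m ⟧))
    (trans (∑-cong (divisorsOf d) (λ {k} _ → sym (monomial-coefficient (monoK κ n k) (φ k) m)))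
           (cong (λ e → unnormalised κ n e m) (sym order≡))))))
    where open CyclicStabilizer (cyclicStabilizer {ρ} ρ∈)

  -- Under the hypothesis the cyclicity test always succeeds, so only the order matters. The test
  -- tries exponents below that order while the hypothesis gives an arbitrary one, hence the
  -- reduction modulo d.
  isCyclicOfOrder≡ : ∀ e {ρ} → ρ ∈ 𝓜 → isCyclicOfOrder G e ρ ≡ (|stab| ρ == e)
  isCyclicOfOrder≡ e {ρ} ρ∈ = trans (cong ((|stab| ρ == e) ∧_) cyclic) (BoolP.∧-identityʳ (|stab| ρ == e))
    where
    open CyclicStabilizer (cyclicStabilizer {ρ} ρ∈)
    instance
      d≢0 : NonZero d
      d≢0 = ℕ.>-nonZero 0<d
    isPower : Perm N → Perm N → Bool
    isPower f h = any (λ i → pow f i =P h) (upTo (|stab| ρ))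
    g-power : ∀ {h} → h ∈ stab G ρ → isPower g h ≡ true
    g-power {h} h∈ = let i , e = generates h∈ in
      any⁺ {p = λ i → pow g i =P h} {x = i DivMod.% d}
        (∈-upTo⁺ (ℕP.<-≤-trans (DivMod.m%n<n i d) (ℕP.≤-reflexive (sym order≡))))
        (=P⁺ {g = pow g (i DivMod.% d)} {h} (trans (sym (pow-mod {κ} 0<d shape i)) e))
    cyclic : any (λ f → all (isPower f) (stab G ρ)) (stab G ρ) ≡ true
    cyclic = any⁺ {p = λ f → all (isPower f) (stab G ρ)} g∈ (all⁺ {p = isPower g} (stab G ρ) g-power)

  |Γ|*numImb : ∀ e → fromℕ (length Γ) * fromℕ (numImb G e) ≡ fromℕ e * ∑ 𝓜 (λ ρ → ⟦ |stab| ρ == e ⟧)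
  |Γ|*numImb e = trans
    (orbitCount-total G (isCyclicOfOrder G e) e
      (λ {ρ} {σ} ρ∈ σ∈ σ∼ρ → trans (isCyclicOfOrder≡ e {σ} σ∈) (trans
        (cong (_== e) (length-stab-invariant G {σ} {ρ} σ∼ρ)) (sym (isCyclicOfOrder≡ e {ρ} ρ∈))))
      (λ {ρ} ρ∈ cyclic → ==⁻ {|stab| ρ} (trans (sym (isCyclicOfOrder≡ e {ρ} ρ∈)) cyclic)))
    (cong (fromℕ e *_) (∑-cong 𝓜 (λ {ρ} ρ∈ → cong ⟦_⟧ (isCyclicOfOrder≡ e {ρ} ρ∈))))

  -- `nFix` is opened into indicators over the maps; after the exchange of sums, the indicators
  -- belonging to a map ρ cut Γ down to the stabilizer of ρ.
  burnside : ∀ m → ∑ Γ (λ γ → if cycleType γ =m m then fromℕ (nFix G γ) else 0ℚ)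
    ≡ ∑ 𝓜 (λ ρ → ∑ (stab G ρ) (λ h → ⟦ cycleType h =m m ⟧))
  burnside m =
    trans (∑-cong Γ (λ {γ} _ → trans (⟦⟧*-if (cycleType γ =m m) (fromℕ (nFix G γ)))
      (trans (cong (⟦ cycleType γ =m m ⟧ *_) (fromℕ-count (λ ρ → act γ ρ =M ρ) 𝓜))
             (∑-*ˡ 𝓜 ⟦ cycleType γ =m m ⟧ (λ ρ → ⟦ act γ ρ =M ρ ⟧)))))
    (trans (∑-swap Γ 𝓜 (λ γ ρ → ⟦ cycleType γ =m m ⟧ * ⟦ act γ ρ =M ρ ⟧))
    (∑-cong 𝓜 (λ {ρ} _ → trans
      (∑-cong Γ (λ {γ} _ → ℚP.*-comm ⟦ cycleType γ =m m ⟧ ⟦ act γ ρ =M ρ ⟧))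
      (sym (∑-filterᵇ (λ γ → act γ ρ =M ρ) Γ (λ h → ⟦ cycleType h =m m ⟧))))))

  -- The stabilizer sums depend on a map only through the order of its stabilizer, so the maps are
  -- grouped by that order; `quotient-transfer` then converts the number of maps in each group into
  -- a number of orbits.
  imbSum-decomposes : Decomposes κ n (imbSum G) (λ d → fromℕ (numImb G d))
  imbSum-decomposes m =
    trans (cong (inv (length Γ) *_) (trans (burnside m) (trans
      (∑-cong 𝓜 (λ {ρ} ρ∈ → stab-cycleTypes m {ρ} ρ∈))
      (∑-fibrewise _==_ (λ k → ==⁺ {k} refl) ==-≢ 𝓜 (divisorsOf n) |stab| (divisorsOf-unique n)
        (λ {ρ} ρ∈ → ∈-divisorsOf⁺ 0<n (|stab|∣n {ρ} ρ∈)) (λ d → unnormalised κ n d m)))))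
    (trans (∑-*ˡ (divisorsOf n) (inv (length Γ)) (λ d → ∑ 𝓜 (λ ρ → ⟦ |stab| ρ == d ⟧) * unnormalised κ n d m))
    (∑-cong (divisorsOf n) (λ {d} d∈ → quotient-transfer
      {fromℕ (length Γ)} {inv (length Γ)} {fromℕ (numImb G d)} {fromℕ d} {inv d} {∑ 𝓜 (λ ρ → ⟦ |stab| ρ == d ⟧)}
      (unnormalised κ n d m) (inv-inverseˡ (Aut-nonempty G)) (inv-inverseˡ (∣⇒0< 0<n (∈-divisorsOf⁻ d∈)))
      (|Γ|*numImb d))))

theorem11 : (n : ℕ) → 0 < n → (κ : Kind) → (G : Graph (verts κ n)) → Connected G
    → (∀ ρ → isMap G ρ ≡ true → CyclicHyp κ n G ρ)
    → (Σ (ℕ → ℚ) (λ c → Decomposes κ n (imbSum G) c))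
      × (∀ c c′ → Decomposes κ n (imbSum G) c → Decomposes κ n (imbSum G) c′
           → ∀ d → d ∣ n → c d ≡ c′ d)
      × (∀ d → d ∣ n →
           fromℕ (numImb G d)
             ≡ fromℕ d * sumℚ (map (λ k → fCoeff κ n G k * inv (φ k) * fromℤ (μ (k div d)))
                                  (filterᵇ (λ k → ⌊ d ∣? k ⌋) (divisorsOf n))))
theorem11 n 0<n κ G _ hyp =
  ((λ d → fromℕ (numImb G d)) , imbSum-decomposes κ 0<n G hyp) ,
  (λ c c′ dec dec′ d d∣n → trans (coefficient-inversion κ {n} {imbSum G} {c} 0<n dec d∣n)
                                 (sym (coefficient-inversion κ {n} {imbSum G} {c′} 0<n dec′ d∣n))) ,
  -- `fCoeff κ n G k` is by definition the coefficient of `imbSum G` at `monoK κ n k`, so the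
  -- inversion for the orbit numbers is literally the formula.
  (λ d d∣n → coefficient-inversion κ {n} {imbSum G} {λ d → fromℕ (numImb G d)} 0<n (imbSum-decomposes κ 0<n G hyp) d∣n)
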